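{- Fix $r\ge1$ and indeterminates $x=(x_0,\dots,x_r)$. For integers $n,k\ge0$ let $g_n^{(k)}\in\mathbb{Z}[x_0,\dots,x_r]$ be the sum of the weights of all two-stack-sortable $k$-tuple $r$-permutations of $[n]$ all of whose $k$ components are nonempty (so $g_0^{(k)}=\delta_{0k}$). Let $g_k=\sum_{n\ge0}g_n^{(k)}\in\mathbb{Q}[[x_0,\dots,x_r]]$, $G=\sum_{k\ge0}g_kz^k$, and define $f_k=\sum_{j\ge0}g_{k+j}e_j(x)$ for $k\ge0$ and $F=\sum_{k\ge0}f_kz^k$. Then $$G=1+zFG.$$ Moreover, $G$ (and hence $F$) is the unique power series $G=\sum_k g_kz^k$ with coefficients $g_k\in\mathbb{Q}[[x_0,\dots,x_r]]$ satisfying $G=1+zFG$ where $F=\sum_k z^k\sum_{j\ge0}g_{k+j}e_j(x)$.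
   Context: An $r$-permutation of a finite set $A$ of positive integers is a word in which each element of $A$ appears exactly $r$ times such that whenever $i<j<k$ and $a_i=a_k$ we have $a_j\le a_i$. A $k$-tuple $r$-permutation of $[n]$ is a tuple $(\alpha_1,\dots,\alpha_k)$ of words such that the concatenation $\alpha_1\cdots\alpha_k$ is an $r$-permutation of $[n]$ and every letter appears in only one $\alpha_i$ (each $\alpha_i$ is then an $r$-permutation of its letter set). Stack sorting $S$: on words with distinct letters, $S(\emptyset)=\emptyset$ and $S(\pi_l m\pi_r)=S(\pi_l)S(\pi_r)m$ where $m$ is the largest letter; on a nonempty $r$-permutation with largest letter $m$, written $\alpha_1m\alpha_2m\cdots m\alpha_{r+1}$, $S(\pi)=S(\alpha_1)\cdots S(\alpha_{r+1})m$. The tuple is two-stack-sortable if $S(S(\alpha_1)S(\alpha_2)\cdots S(\alpha_k))$ is the identity $12\cdots n$. Descents of an $r$-permutation: a letter $a$ is a type $i$ descent ($1\le i\le r$) if its $i$th occurrence is immediately followed by a smaller letter, and a type $0$ descent if its first occurrence immediately follows a smaller letter. The set of type $i$ descents of a $k$-tuple is the union of those of its components, and the weight of the tuple is $\prod_{i=0}^r x_i^{(\text{number of type } i\text{ descents})}$. $e_j(x)$ is the $j$th elementary symmetric polynomial in $x_0,\dots,x_r$ (zero for $j>r+1$). -}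

module Defs where

open import Data.Bool using (Bool; true; false; _∧_; _∨_; not; if_then_else_)
open import Data.Nat as ℕ using (ℕ; zero; suc; _∸_; _≤_; _≡ᵇ_; _<ᵇ_)
open import Data.Fin using (Fin; toℕ)
open import Data.List as List using (List; []; _∷_; _++_; [_]; length; map; concat; concatMap; upTo; foldr; applyUpTo)
open import Data.Vec as Vec using (Vec; []; _∷_; tabulate; zipWith)
open import Data.Vec.Properties using (≡-dec)
import Data.List.Properties as LP
open import Data.Maybe using (Maybe; just; nothing)
open import Data.Integer using (+_)
open import Data.Rational as ℚ using (ℚ; 0ℚ; 1ℚ)
open import Relation.Binary.PropositionalEquality using (_≡_)
open import Relation.Nullary.Decidable using (does)
open import Data.Product using (∃)

Word : Set
Word = List ℕ

idWord : ℕ → Word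
idWord n = applyUpTo suc n

elem : ℕ → Word → Bool
elem a []      = false
elem a (b ∷ w) = (a ≡ᵇ b) ∨ elem a w

count : ℕ → Word → ℕ
count a []      = 0
count a (b ∷ w) = (if a ≡ᵇ b then 1 else 0) ℕ.+ count a w

allB : {A : Set} → (A → Bool) → List A → Bool
allB p []      = true
allB p (x ∷ xs) = p x ∧ allB p xs

anyB : {A : Set} → (A → Bool) → List A → Bool
anyB p []      = false
anyB p (x ∷ xs) = p x ∨ anyB p xs

filterB : {A : Set} → (A → Bool) → List A → List A
filterB p []       = []
filterB p (x ∷ xs) = if p x then x ∷ filterB p xs else filterB p xs

sumℕ : List ℕ → ℕ
sumℕ = foldr ℕ._+_ 0

at : Word → ℕ → Maybe ℕ
at []      _       = nothing
at (b ∷ w) zero    = just b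
at (b ∷ w) (suc i) = at w i

positions : ℕ → Word → List ℕ
positions a w = go 0 w
  where
  go : ℕ → Word → List ℕ
  go i []      = []
  go i (b ∷ w) = if a ≡ᵇ b then i ∷ go (suc i) w else go (suc i) w

-- r-permutations.
-- Pattern condition: whenever i<j<k and a_i = a_k, then a_j ≤ a_i.
-- 'patOK a w' : every letter b of w that has a later occurrence of a
-- after it satisfies b ≤ a.

patFrom : ℕ → Word → Bool
patFrom a []      = true
patFrom a (b ∷ w) = (not (elem a w) ∨ (b ℕ.≤ᵇ a)) ∧ patFrom a w

patternOK : Word → Bool
patternOK []      = true
patternOK (a ∷ w) = patFrom a w ∧ patternOK w

isRPermOf : ℕ → Word → Word → Bool
isRPermOf r A w = allB (λ b → elem b A) w ∧ allB (λ a → count a w ≡ᵇ r) A ∧ patternOK w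

wordsOf : ℕ → ℕ → List Word
wordsOf n zero    = [] ∷ []
wordsOf n (suc ℓ) = concatMap (λ a → map (a ∷_) (wordsOf n ℓ)) (idWord n)

-- all r-permutations of [n] (each appears exactly once in this list)
rPerms : ℕ → ℕ → List Word
rPerms r n = filterB (λ w → isRPermOf r (idWord n) w) (wordsOf n (r ℕ.* n))

splits : ℕ → Word → List (List Word)
splits zero    []      = [] ∷ []
splits zero    (_ ∷ _) = []
splits (suc k) w       = concatMap choose (upTo (length w))
  where
  choose : ℕ → List (List Word)
  choose i = map (List.take (suc i) w ∷_) (splits k (List.drop (suc i) w))

disjointComponents : List Word → Bool
disjointComponents []       = true
disjointComponents (α ∷ αs) =
  allB (λ a → not (anyB (elem a) αs)) α ∧ disjointComponents αs

tuples : ℕ → ℕ → ℕ → List (List Word)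
tuples r n k =
  filterB (λ t → disjointComponents t)
         (concatMap (splits k) (rPerms r n))

-- Stack sorting.  For a nonempty word with largest letter m, written
-- α₁ m α₂ m ⋯ m α_{s+1} (the α's free of m),
-- S(π) = S(α₁) ⋯ S(α_{s+1}) m.  For words with distinct letters this is
-- S(π_l m π_r) = S(π_l) S(π_r) m, and for r-permutations it is the
-- paper's definition.  'fuel' (≥ length) only ensures termination.

maxW : Word → ℕ
maxW = foldr ℕ._⊔_ 0

splitAt : ℕ → Word → List Word
splitAt m []      = [] ∷ []
splitAt m (b ∷ w) with splitAt m w
... | []       = [ b ∷ [] ]   -- impossible
... | (u ∷ us) = if m ≡ᵇ b then [] ∷ u ∷ us else (b ∷ u) ∷ us

stackSortF : ℕ → Word → Word
stackSortF _        []       = []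
stackSortF zero     (_ ∷ _)  = []     -- never reached with enough fuel
stackSortF (suc f)  w@(_ ∷ _) =
  concat (map (stackSortF f) (splitAt (maxW w) w)) ++ [ maxW w ]

S : Word → Word
S w = stackSortF (length w) w

twoStackSortable : ℕ → List Word → Bool
twoStackSortable n t =
  does (LP.≡-dec ℕ._≟_ (S (concat (map S t))) (idWord n))

-- Descents.  a is a type i descent (1 ≤ i ≤ r) of α if the i-th
-- occurrence of a is immediately followed by a smaller letter; a type 0
-- descent if its first occurrence immediately follows a smaller letter.

smallerAt : ℕ → Word → ℕ → Bool
smallerAt a w p with at w p
... | just b  = b <ᵇ a
... | nothing = false

isDescent : ℕ → ℕ → Word → Bool
isDescent zero a α with positions a α
... | []          = false
... | zero  ∷ _   = false
... | suc p ∷ _   = smallerAt a α p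
isDescent (suc i) a α with at' (positions a α) i
  where
  at' : List ℕ → ℕ → Maybe ℕ
  at' []       _       = nothing
  at' (p ∷ ps) zero    = just p
  at' (p ∷ ps) (suc j) = at' ps j
... | just p  = smallerAt a α (suc p)
... | nothing = false

numDescents : ℕ → ℕ → List Word → ℕ
numDescents n i t =
  length (filterB (λ a → anyB (isDescent i a) t) (idWord n))

-- Monomials in x₀,…,x_r: exponent vectors.  Power series with rational
-- coefficients in x₀,…,x_r: functions from monomials to ℚ.

Mon : ℕ → Set
Mon r = Vec ℕ (suc r)

Series : ℕ → Set
Series r = Mon r → ℚ

weight : (r n : ℕ) → List Word → Mon r
weight r n t = tabulate (λ (i : Fin (suc r)) → numDescents n (toℕ i) t)

gCoeff : (r n k : ℕ) → Mon r → ℕ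
gCoeff r n k m =
  length (filterB (λ t → twoStackSortable n t
                        ∧ does (≡-dec ℕ._≟_ (weight r n t) m))
                 (tuples r n k))

partialSum : (r k : ℕ) → Mon r → ℕ → ℕ
partialSum r k m zero    = 0
partialSum r k m (suc N) = partialSum r k m N ℕ.+ gCoeff r N k m

fromℕ : ℕ → ℚ
fromℕ n = + n ℚ./ 1

-- g k = Σ_{n ≥ 0} g_n^{(k)} in ℚ[[x]]: for every monomial the partial
-- sums are eventually equal to the coefficient of g k.
IsGFamily : (r : ℕ) → (ℕ → Series r) → Set
IsGFamily r g = ∀ k (m : Mon r) → ∃ λ N → ∀ N′ → N ≤ N′ → g k m ≡ fromℕ (partialSum r k m N′)

sumℚ : List ℚ → ℚ
sumℚ = foldr ℚ._+_ 0ℚ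

below : {s : ℕ} → Vec ℕ s → List (Vec ℕ s)
below []      = [] ∷ []
below (a ∷ m) = concatMap (λ i → map (i ∷_) (below m)) (upTo (suc a))

_+ₛ_ : {r : ℕ} → Series r → Series r → Series r
(p +ₛ q) m = p m ℚ.+ q m

_*ₛ_ : {r : ℕ} → Series r → Series r → Series r
(p *ₛ q) m = sumℚ (map (λ d → p d ℚ.* q (zipWith _∸_ m d)) (below m))

zeroₛ : {r : ℕ} → Series r
zeroₛ _ = 0ℚ

oneₛ : {r : ℕ} → Series r
oneₛ m = if allB (λ e → e ≡ᵇ 0) (Vec.toList m) then 1ℚ else 0ℚ

elemSym : {r : ℕ} → ℕ → Series r
elemSym j m =
  if allB (λ e → e ℕ.≤ᵇ 1) (Vec.toList m) ∧ (sumℕ (Vec.toList m) ≡ᵇ j)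
  then 1ℚ else 0ℚ

sumₛ : {r : ℕ} → List (Series r) → Series r
sumₛ = foldr _+ₛ_ zeroₛ

ZSeries : ℕ → Set
ZSeries r = ℕ → Series r

-- f_k = Σ_{j ≥ 0} g_{k+j} e_j(x)  (terms with j > r+1 vanish)
Fof : {r : ℕ} → ZSeries r → ZSeries r
Fof {r} g k = sumₛ (map (λ j → g (k ℕ.+ j) *ₛ elemSym j) (upTo (suc (suc r))))

_*z_ : {r : ℕ} → ZSeries r → ZSeries r → ZSeries r
(A *z B) k = sumₛ (map (λ a → A a *ₛ B (k ∸ a)) (upTo (suc k)))

_+z_ : {r : ℕ} → ZSeries r → ZSeries r → ZSeries r
(A +z B) k = A k +ₛ B k

oneZ : {r : ℕ} → ZSeries r
oneZ zero    = oneₛ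
oneZ (suc _) = zeroₛ

zTimes : {r : ℕ} → ZSeries r → ZSeries r
zTimes A zero    = zeroₛ
zTimes A (suc k) = A k

SatisfiesEq : (r : ℕ) → ZSeries r → Set
SatisfiesEq r G = ∀ k (m : Mon r) → G k m ≡ (oneZ +z zTimes (Fof G *z G)) k m

{-# OPTIONS --safe #-}

-- Cut a tuple of [n] at its largest letter n: t = αs, β₀ n β₁ n ⋯ n β_r, γs.  The sorted components
-- concatenate to S(αs) S(β₀) ⋯ S(β_r) n S(γs), so a second pass of S gives the identity exactly when
-- the tuple made of αs and the nonempty βs is two-stack-sortable on an initial interval of letters and
-- γs is on the complementary one.  The letter n has a type i descent iff β_i is nonempty, hence the
-- choice of the nonempty βs contributes e_j, and the cut is the equation G = 1 + zFG.  It also shows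
-- that the number of letters is k plus the total number of descents, so every monomial determines n,
-- and the equation determines the coefficient of z^k x^m by recursion on k + |m|.

module Submission where

open import Defs
import Data.Nat
import Data.Nat.Properties
open import Algebra.Properties.CommutativeSemigroup Data.Nat.Properties.+-commutativeSemigroup
  using () renaming (interchange to +-interchange)
open import Data.Bool using (Bool; true; false; if_then_else_; _∧_; _∨_; not; T)
open import Data.Bool.Properties using (∨-identityʳ; ∨-assoc; T-∧; T-∨; T-≡)
open import Data.Empty using (⊥-elim)
open import Data.Fin using (Fin; toℕ; zero; suc)
import Data.Integer as ℤ
import Data.Integer.Properties as ℤ
open import Data.List
  using (List; []; _∷_; [_]; _++_; applyUpTo; cartesianProduct; concat; concatMap; drop; length; map; take;
    upTo)
open import Data.List.Membership.DecPropositional Data.Nat._≟_ using (_∈?_)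
open import Data.List.Membership.Propositional using (_∈_; _∉_; find; lose)
open import Data.List.Membership.Propositional.Properties
  using (∈-++⁺ˡ; ∈-++⁺ʳ; ∈-++⁻; ∈-∃++; ∈-cartesianProduct⁺; ∈-cartesianProduct⁻; ∈-concatMap⁺; ∈-concatMap⁻;
    ∈-map⁺; ∈-map⁻; ∈-upTo⁺; ∈-upTo⁻)
open import Data.List.Properties
  using (++-assoc; ++-identityʳ; concat-++; length-++; length-++-≤ˡ; length-++-≤ʳ; length-drop; length-map;
    length-take; map-++; map-cong-local; take++drop≡id; ∷-injective; ∷ʳ-injectiveˡ; ≡-dec)
open import Data.List.Relation.Unary.All as All using (All; []; _∷_)
import Data.List.Relation.Unary.All.Properties as All
open import Data.List.Relation.Unary.AllPairs using ([]; _∷_)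
open import Data.List.Relation.Unary.Any using (here; there)
open import Data.List.Relation.Unary.Unique.Propositional using (Unique)
import Data.List.Relation.Unary.Unique.Propositional.Properties as Unique
open import Data.Maybe using (just; nothing)
open import Data.Nat using (ℕ; zero; suc; _+_; _*_; _∸_; _≤_; _<_; _≡ᵇ_; _<ᵇ_; _≤ᵇ_; _≟_; z≤n; s≤s; s≤s⁻¹)
open import Data.Nat.Properties
open import Data.Product using (Σ; ∃; ∃₂; _×_; _,_; proj₁; proj₂)
open import Data.Rational as ℚ using (ℚ; 0ℚ; 1ℚ)
import Data.Rational.Properties as ℚ
open import Data.Rational.Unnormalised as ℚᵘ using (mkℚᵘ; *≡*)
import Data.Rational.Unnormalised.Properties as ℚᵘ
open import Data.Sum using (_⊎_; inj₁; inj₂; [_,_]′)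
open import Data.Unit using (⊤; tt)
open import Data.Vec as Vec using (Vec; []; _∷_; toList; lookup; tabulate; zipWith)
import Data.Vec.Properties as Vec
open import Function using (_∘_; Equivalence)
open import Relation.Nullary using (Dec; yes; no; ¬_; does)
open import Relation.Binary.PropositionalEquality hiding ([_])

-- Descents by recursion on the word

-- The equation is not a recursion on k alone: f_a contains g_{a+j} with j up to r + 1, so the
-- number of components may grow on the left of the cut. What saves the recursion is that e_j has
-- degree j: each additional component is paid for by one unit of |m|. In combinatorial terms, `αs`
-- and the nonempty `βs` form a single tuple that remembers neither where `αs` ends nor which blocks
-- were empty. The missing data are a number a and a subset of {0, ..., r} of size j; the subset is
-- kept as a squarefree exponent vector, the very monomial that the descents of the largest letter
-- contribute. No tuple is ever standardised: `γs` keeps its letters, and everything is stated for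
-- letters lo + 1, ..., lo + n. Counting compares two lists without repetitions, the filtered list
-- behind `gCoeff` and the recursive list `gen`, whose nested ranges copy the sums in the product of
-- series. Equal membership gives equal length, and the length of `gen` obeys the recursion by
-- construction.

positionsFrom : ℕ → ℕ → Word → List ℕ
positionsFrom a i []      = []
positionsFrom a i (b ∷ w) =
  if a ≡ᵇ b then i ∷ positionsFrom a (suc i) w else positionsFrom a (suc i) w

-- positions calls a local function that cannot be named here and that takes its whole word as a hidden
-- parameter.  The with-abstraction of that word turns the call into one with distinct variables as
-- arguments, which lets unification recover the function; its defining equations then determine it.
PositionsStep : ℕ → (ℕ → Word → List ℕ) → Set
PositionsStep a f = ∀ i b w → f i (b ∷ w) ≡ (if a ≡ᵇ b then i ∷ f (suc i) w else f (suc i) w)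

Extends : ℕ → (ℕ → Word → List ℕ) → Set
Extends a f = ∀ i w → f i w ≡ positionsFrom a i w

positionsFrom-unique : ∀ a (f : ℕ → Word → List ℕ) → (∀ i → f i [] ≡ []) → PositionsStep a f →
                       ∀ i w → f i w ≡ positionsFrom a i w
positionsFrom-unique a f nil step i []      = nil i
positionsFrom-unique a f nil step i (b ∷ w)
  rewrite step i b w | positionsFrom-unique a f nil step (suc i) w = refl

mutual
  positions≡positionsFrom : ∀ a w → positions a w ≡ positionsFrom a 0 w
  positions≡positionsFrom a []      = refl
  positions≡positionsFrom a (b ∷ w) with a ≡ᵇ b | 1 | b ∷ w
  ... | true  | i | v = cong (0 ∷_) (go≡positionsFrom a v i w)
  ... | false | i | v = go≡positionsFrom a v i w

  go≡positionsFrom : ∀ a (v : Word) → Extends a _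
  go≡positionsFrom a v = positionsFrom-unique a _ (λ _ → refl) (λ _ _ _ → refl)

descentAtNth : ℕ → Word → List ℕ → ℕ → Bool
descentAtNth a α []       _       = false
descentAtNth a α (p ∷ ps) zero    = smallerAt a α (suc p)
descentAtNth a α (p ∷ ps) (suc j) = descentAtNth a α ps j

IsDescentAtNth : ℕ → Word → (List ℕ → ℕ → Bool) → Set
IsDescentAtNth a α f = ∀ ps j → f ps j ≡ descentAtNth a α ps j

descentAtNth-unique : ∀ a α (f : List ℕ → ℕ → Bool) → (∀ j → f [] j ≡ false) →
  (∀ p ps → f (p ∷ ps) zero ≡ smallerAt a α (suc p)) →
  (∀ p ps j → f (p ∷ ps) (suc j) ≡ f ps j) → IsDescentAtNth a α f
descentAtNth-unique a α f e1 e2 e3 []       j       = e1 j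
descentAtNth-unique a α f e1 e2 e3 (p ∷ ps) zero    = e2 p ps
descentAtNth-unique a α f e1 e2 e3 (p ∷ ps) (suc j) =
  trans (e3 p ps j) (descentAtNth-unique a α f e1 e2 e3 ps j)

mutual
  isDescent-suc : ∀ i a α → isDescent (suc i) a α ≡ descentAtNth a α (positions a α) i
  isDescent-suc i a α with positions a α
  isDescent-suc i       a α | []     = refl
  isDescent-suc zero    a α | p ∷ ps = refl
  -- The local lookup in `isDescent` carries the whole index as a hidden parameter. Abstracting
  -- `suc j` again leaves a call on distinct variables, from which the underscore in
  -- `descent≡descentAtNth` is solved.
  isDescent-suc (suc j) a α | p ∷ ps with suc j
  ... | i = descent≡descentAtNth i a α ps j

  descent≡descentAtNth : ∀ (i a : ℕ) (α : Word) → IsDescentAtNth a α _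
  descent≡descentAtNth i a α = descentAtNth-unique a α _ (λ _ → refl) (λ _ _ → refl) (λ _ _ _ → refl)

-- The flag `s` tells whether the letter just before the current one is smaller than `a`. It starts
-- as `false`, since the first letter of a word has no predecessor.
firstDescent : ℕ → Bool → Word → Bool
firstDescent a s []      = false
firstDescent a s (b ∷ w) = if a ≡ᵇ b then s else firstDescent a (b <ᵇ a) w

startsBelow : ℕ → Word → Bool
startsBelow a []      = false
startsBelow a (b ∷ w) = b <ᵇ a

-- The index is zero-based: `laterDescent i` inspects occurrence number i + 1, that is, type i + 1
-- descents.
laterDescent : ℕ → ℕ → Word → Bool
laterDescent i       a []      = false
laterDescent zero    a (b ∷ w) = if a ≡ᵇ b then startsBelow a w else laterDescent zero a w
laterDescent (suc i) a (b ∷ w) = if a ≡ᵇ b then laterDescent i a w else laterDescent (suc i) a w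

-- Descents inspect a word only through `at`, so agreement of lookups is all that is needed to trade
-- absolute positions in `α` for recursion on the remaining suffix.
SuffixFrom : ℕ → Word → Word → Set
SuffixFrom i α w = ∀ j → at α (i + j) ≡ at w j

suffixFrom-tail : ∀ {i α b w} → SuffixFrom i α (b ∷ w) → SuffixFrom (suc i) α w
suffixFrom-tail {i} {α} suff j = trans (cong (at α) (sym (+-suc i j))) (suff (suc j))

smallerAt-cong : ∀ a {α β} p q → at α p ≡ at β q → smallerAt a α p ≡ smallerAt a β q
smallerAt-cong a {α} {β} p q eq rewrite eq with at β q
... | just _  = refl
... | nothing = refl

smallerAt-head : ∀ a w → smallerAt a w 0 ≡ startsBelow a w
smallerAt-head a []      = refl
smallerAt-head a (b ∷ w) = refl

descentAtNth-positions : ∀ n a α i w → SuffixFrom i α w →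
                         descentAtNth a α (positionsFrom a i w) n ≡ laterDescent n a w
descentAtNth-positions n a α i [] suff = refl
descentAtNth-positions zero a α i (b ∷ w) suff with a ≡ᵇ b
... | true  = trans (smallerAt-cong a {α} {w} (suc i) 0
                       (trans (cong (λ j → at α (suc j)) (sym (+-identityʳ i)))
                              (suffixFrom-tail {i} {α} suff 0)))
                    (smallerAt-head a w)
... | false = descentAtNth-positions zero a α (suc i) w (suffixFrom-tail {i} {α} suff)
descentAtNth-positions (suc n) a α i (b ∷ w) suff with a ≡ᵇ b
... | true  = descentAtNth-positions n a α (suc i) w (suffixFrom-tail {i} {α} suff)
... | false = descentAtNth-positions (suc n) a α (suc i) w (suffixFrom-tail {i} {α} suff)

isDescent-later : ∀ i a α → isDescent (suc i) a α ≡ laterDescent i a α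
isDescent-later i a α = trans (isDescent-suc i a α)
  (trans (cong (λ ps → descentAtNth a α ps i) (positions≡positionsFrom a α))
         (descentAtNth-positions i a α 0 α (λ _ → refl)))

beforeFirst : ℕ → Word → List ℕ → Bool
beforeFirst a α []          = false
beforeFirst a α (zero ∷ _)  = false
beforeFirst a α (suc p ∷ _) = smallerAt a α p

isDescent-zero : ∀ a α → isDescent 0 a α ≡ beforeFirst a α (positions a α)
isDescent-zero a α with positions a α
... | []        = refl
... | zero ∷ _  = refl
... | suc _ ∷ _ = refl

beforeFirst-positions : ∀ a α i c w → SuffixFrom i α (c ∷ w) →
                        beforeFirst a α (positionsFrom a (suc i) w) ≡ firstDescent a (c <ᵇ a) w
beforeFirst-positions a α i c []      suff = refl
beforeFirst-positions a α i c (b ∷ w) suff with a ≡ᵇ b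
... | true  = smallerAt-cong a {α} {c ∷ []} i 0 (trans (cong (at α) (sym (+-identityʳ i))) (suff 0))
... | false = beforeFirst-positions a α (suc i) b w (suffixFrom-tail {i} {α} suff)

isDescent-first : ∀ a α → isDescent 0 a α ≡ firstDescent a false α
isDescent-first a []      = refl
isDescent-first a (b ∷ w) = trans (isDescent-zero a (b ∷ w))
  (trans (cong (beforeFirst a (b ∷ w)) (positions≡positionsFrom a (b ∷ w))) go)
  where
  go : beforeFirst a (b ∷ w) (positionsFrom a 0 (b ∷ w)) ≡ firstDescent a false (b ∷ w)
  go with a ≡ᵇ b
  ... | true  = refl
  ... | false = beforeFirst-positions a (b ∷ w) 0 b w (λ _ → refl)

-- Descents of words glued together by a larger letter

≡ᵇ-refl : ∀ a → (a ≡ᵇ a) ≡ true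
≡ᵇ-refl zero    = refl
≡ᵇ-refl (suc a) = ≡ᵇ-refl a

≢⇒≡ᵇ-false : ∀ {a b} → a ≢ b → (a ≡ᵇ b) ≡ false
≢⇒≡ᵇ-false {zero}  {zero}  a≢b = ⊥-elim (a≢b refl)
≢⇒≡ᵇ-false {zero}  {suc b} a≢b = refl
≢⇒≡ᵇ-false {suc a} {zero}  a≢b = refl
≢⇒≡ᵇ-false {suc a} {suc b} a≢b = ≢⇒≡ᵇ-false (a≢b ∘ cong suc)

<⇒<ᵇ-true : ∀ {a b} → a < b → (a <ᵇ b) ≡ true
<⇒<ᵇ-true {zero}  {suc b} _         = refl
<⇒<ᵇ-true {suc a} {suc b} (s≤s a<b) = <⇒<ᵇ-true a<b

≤⇒<ᵇ-false : ∀ {a b} → b ≤ a → (a <ᵇ b) ≡ false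
≤⇒<ᵇ-false {a}     {zero}  _         = refl
≤⇒<ᵇ-false {suc a} {suc b} (s≤s b≤a) = ≤⇒<ᵇ-false b≤a

firstDescent-∉ : ∀ {a} s w → a ∉ w → firstDescent a s w ≡ false
firstDescent-∉ s []      a∉w = refl
firstDescent-∉ {a} s (b ∷ w) a∉w rewrite ≢⇒≡ᵇ-false {a} {b} (a∉w ∘ here) =
  firstDescent-∉ _ w (a∉w ∘ there)

firstDescent-++ˡ : ∀ {a} s u {v} → a ∈ u → firstDescent a s (u ++ v) ≡ firstDescent a s u
firstDescent-++ˡ {a} s (b ∷ u) a∈ with a ≟ b
... | yes refl rewrite ≡ᵇ-refl a = refl
firstDescent-++ˡ {a} s (b ∷ u) (here a≡b) | no a≢b = ⊥-elim (a≢b a≡b)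
firstDescent-++ˡ {a} s (b ∷ u) (there a∈) | no a≢b rewrite ≢⇒≡ᵇ-false a≢b = firstDescent-++ˡ _ u a∈

firstDescent-++ʳ : ∀ {a m} s u {v} → a ≢ m → a ∉ u →
                   firstDescent a s (u ++ m ∷ v) ≡ firstDescent a (m <ᵇ a) v
firstDescent-++ʳ s []      a≢m a∉u rewrite ≢⇒≡ᵇ-false a≢m = refl
firstDescent-++ʳ {a} s (b ∷ u) a≢m a∉u rewrite ≢⇒≡ᵇ-false {a} {b} (a∉u ∘ here) =
  firstDescent-++ʳ _ u a≢m (a∉u ∘ there)

firstDescent-top : ∀ {m} u {v} → (∀ {y} → y ∈ u → y < m) → firstDescent m true (u ++ m ∷ v) ≡ true
firstDescent-top {m} []      u<m rewrite ≡ᵇ-refl m = refl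
firstDescent-top {m} (b ∷ u) u<m
  rewrite ≢⇒≡ᵇ-false (≢-sym (<⇒≢ (u<m (here refl)))) | <⇒<ᵇ-true (u<m (here refl)) =
  firstDescent-top u (u<m ∘ there)

laterDescent-∉ : ∀ i {a} w → a ∉ w → laterDescent i a w ≡ false
laterDescent-∉ zero    []      a∉w = refl
laterDescent-∉ (suc i) []      a∉w = refl
laterDescent-∉ zero    {a} (b ∷ w) a∉w rewrite ≢⇒≡ᵇ-false {a} {b} (a∉w ∘ here) =
  laterDescent-∉ zero w (a∉w ∘ there)
laterDescent-∉ (suc i) {a} (b ∷ w) a∉w rewrite ≢⇒≡ᵇ-false {a} {b} (a∉w ∘ here) =
  laterDescent-∉ (suc i) w (a∉w ∘ there)

laterDescent-++ʳ : ∀ i {a} u {v} → a ∉ u → laterDescent i a (u ++ v) ≡ laterDescent i a v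
laterDescent-++ʳ i       []      a∉u = refl
laterDescent-++ʳ zero    {a} (b ∷ u) a∉u rewrite ≢⇒≡ᵇ-false {a} {b} (a∉u ∘ here) =
  laterDescent-++ʳ zero u (a∉u ∘ there)
laterDescent-++ʳ (suc i) {a} (b ∷ u) a∉u rewrite ≢⇒≡ᵇ-false {a} {b} (a∉u ∘ here) =
  laterDescent-++ʳ (suc i) u (a∉u ∘ there)

∉-∷ : ∀ {a m : ℕ} {v} → a ≢ m → a ∉ v → a ∉ m ∷ v
∉-∷ a≢m a∉v (here a≡m)  = a≢m a≡m
∉-∷ a≢m a∉v (there a∈v) = a∉v a∈v

∉-++ : ∀ {a : ℕ} u {v} → a ∉ u → a ∉ v → a ∉ u ++ v
∉-++ u a∉u a∉v a∈ with ∈-++⁻ u a∈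
... | inj₁ a∈u = a∉u a∈u
... | inj₂ a∈v = a∉v a∈v

startsBelow-++ˡ : ∀ {a m} u {v} → a < m → startsBelow a (u ++ m ∷ v) ≡ startsBelow a u
startsBelow-++ˡ []      a<m = ≤⇒<ᵇ-false (<⇒≤ a<m)
startsBelow-++ˡ (b ∷ u) a<m = refl

laterDescent-++ˡ : ∀ i {a m} u {v} → a < m → a ∉ v →
                   laterDescent i a (u ++ m ∷ v) ≡ laterDescent i a u
laterDescent-++ˡ zero    []      a<m a∉v = laterDescent-∉ zero _ (∉-∷ (<⇒≢ a<m) a∉v)
laterDescent-++ˡ (suc i) []      a<m a∉v = laterDescent-∉ (suc i) _ (∉-∷ (<⇒≢ a<m) a∉v)
laterDescent-++ˡ zero    {a} (b ∷ u) a<m a∉v with a ≡ᵇ b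
... | true  = startsBelow-++ˡ u a<m
... | false = laterDescent-++ˡ zero u a<m a∉v
laterDescent-++ˡ (suc i) {a} (b ∷ u) a<m a∉v with a ≡ᵇ b
... | true  = laterDescent-++ˡ i u a<m a∉v
... | false = laterDescent-++ˡ (suc i) u a<m a∉v

isDescent-∉ : ∀ i {a} w → a ∉ w → isDescent i a w ≡ false
isDescent-∉ zero    w a∉w = trans (isDescent-first _ w) (firstDescent-∉ false w a∉w)
isDescent-∉ (suc i) w a∉w = trans (isDescent-later i _ w) (laterDescent-∉ i w a∉w)

-- A larger neighbour never makes a descent: `m` after an `a` is not smaller than `a`, and an `a`
-- right after `m` does not follow a smaller letter. So each side of `m` keeps its own descents;
-- `isDescent-++ʳ` is the other side.
isDescent-++ˡ : ∀ i {a m} u {v} → a < m → a ∉ v → isDescent i a (u ++ m ∷ v) ≡ isDescent i a u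
isDescent-++ˡ zero {a} u a<m a∉v with a ∈? u
... | yes a∈u = trans (isDescent-first _ (u ++ _))
                  (trans (firstDescent-++ˡ false u a∈u) (sym (isDescent-first _ u)))
... | no  a∉u = trans (isDescent-∉ 0 (u ++ _) (∉-++ u a∉u (∉-∷ (<⇒≢ a<m) a∉v)))
                  (sym (isDescent-∉ 0 u a∉u))
isDescent-++ˡ (suc i) u a<m a∉v = trans (isDescent-later i _ (u ++ _))
  (trans (laterDescent-++ˡ i u a<m a∉v) (sym (isDescent-later i _ u)))

isDescent-++ʳ : ∀ i {a m} u {v} → a < m → a ∉ u → isDescent i a (u ++ m ∷ v) ≡ isDescent i a v
isDescent-++ʳ zero {a} u {v} a<m a∉u = trans (isDescent-first _ (u ++ _))
  (trans (firstDescent-++ʳ false u (<⇒≢ a<m) a∉u)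
  (trans (cong (λ s → firstDescent a s v) (≤⇒<ᵇ-false (<⇒≤ a<m))) (sym (isDescent-first _ v))))
isDescent-++ʳ (suc i) {a} u {v} a<m a∉u = trans (isDescent-later i _ (u ++ _))
  (trans (laterDescent-++ʳ i u a∉u)
  (trans (laterDescent-++ʳ i (_ ∷ []) (∉-∷ (<⇒≢ a<m) (λ ()))) (sym (isDescent-later i _ v))))

-- With s + 1 blocks there are s copies of the separator `m`; a vector of type
-- `Vec Word (suc (suc s))` therefore guarantees that `m` occurs.
glue : ∀ {s} → ℕ → Vec Word (suc s) → Word
glue {zero}  m (β ∷ []) = β
glue {suc s} m (β ∷ βs) = β ++ m ∷ glue m βs

letters : ∀ {s} → Vec Word s → Word
letters βs = concat (toList βs)

∈-glue⁻ : ∀ {s y} m (βs : Vec Word (suc s)) → y ∈ glue m βs → y ≡ m ⊎ y ∈ letters βs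
∈-glue⁻ {zero}  m (β ∷ []) y∈ = inj₂ (∈-++⁺ˡ y∈)
∈-glue⁻ {suc s} m (β ∷ βs) y∈ with ∈-++⁻ β y∈
... | inj₁ y∈β         = inj₂ (∈-++⁺ˡ y∈β)
... | inj₂ (here y≡m)  = inj₁ y≡m
... | inj₂ (there y∈g) with ∈-glue⁻ m βs y∈g
... | inj₁ y≡m = inj₁ y≡m
... | inj₂ y∈l = inj₂ (∈-++⁺ʳ β y∈l)

∈-glue⁺ : ∀ {s y} m (βs : Vec Word (suc s)) → y ∈ letters βs → y ∈ glue m βs
∈-glue⁺ {zero}  m (β ∷ []) y∈ with ∈-++⁻ β y∈
... | inj₁ y∈β = y∈β
∈-glue⁺ {suc s} m (β ∷ βs) y∈ with ∈-++⁻ β y∈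
... | inj₁ y∈β = ∈-++⁺ˡ y∈β
... | inj₂ y∈l = ∈-++⁺ʳ β (there (∈-glue⁺ m βs y∈l))

top∈glue : ∀ {s} m (βs : Vec Word (suc (suc s))) → m ∈ glue m βs
top∈glue m (β ∷ βs) = ∈-++⁺ʳ β (here refl)

Disj : Word → Word → Set
Disj u v = ∀ {y} → y ∈ u → y ∉ v

Separated : List Word → Set
Separated []      = ⊤
Separated (α ∷ t) = Disj α (concat t) × Separated t

anyB-descent-∉ : ∀ i {a} t → a ∉ concat t → anyB (isDescent i a) t ≡ false
anyB-descent-∉ i []      a∉ = refl
anyB-descent-∉ i (α ∷ t) a∉
  rewrite isDescent-∉ i α (a∉ ∘ ∈-++⁺ˡ) = anyB-descent-∉ i t (a∉ ∘ ∈-++⁺ʳ α)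

isDescent-glue : ∀ {s} i {a m} (βs : Vec Word (suc s)) → a < m → Separated (toList βs) →
                 isDescent i a (glue m βs) ≡ anyB (isDescent i a) (toList βs)
isDescent-glue {zero}  i (β ∷ []) a<m sep = sym (∨-identityʳ _)
isDescent-glue {suc s} i {a} {m} (β ∷ βs) a<m (dis , sep) with a ∈? β
... | no a∉β rewrite isDescent-∉ i β a∉β =
  trans (isDescent-++ʳ i β a<m a∉β) (isDescent-glue i βs a<m sep)
... | yes a∈β rewrite anyB-descent-∉ i (toList βs) (dis a∈β) =
  trans (isDescent-++ˡ i β a<m a∉g) (sym (∨-identityʳ _))
  where
  a∉g : a ∉ glue m βs
  a∉g a∈g with ∈-glue⁻ m βs a∈g
  ... | inj₁ a≡m = <⇒≢ a<m a≡m
  ... | inj₂ a∈l = dis a∈β a∈l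

isNonempty : Word → Bool
isNonempty []      = false
isNonempty (_ ∷ _) = true

Below : ℕ → Word → Set
Below m w = ∀ {y} → y ∈ w → y < m

below∌ : ∀ {m w} → Below m w → m ∉ w
below∌ w<m m∈w = <-irrefl refl (w<m m∈w)

startsBelow-glue : ∀ {s} m (βs : Vec Word (suc s)) → Below m (letters βs) →
                   startsBelow m (glue m βs) ≡ isNonempty (Vec.head βs)
startsBelow-glue {zero}  m ([] ∷ [])       l<m = refl
startsBelow-glue {zero}  m ((b ∷ _) ∷ [])  l<m = <⇒<ᵇ-true (l<m (here refl))
startsBelow-glue {suc s} m ([] ∷ βs)       l<m = ≤⇒<ᵇ-false {m} ≤-refl
startsBelow-glue {suc s} m ((b ∷ _) ∷ βs)  l<m = <⇒<ᵇ-true (l<m (here refl))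

laterDescent-glue : ∀ {s} m (βs : Vec Word (suc s)) → Below m (letters βs) → (i : Fin s) →
                    laterDescent (toℕ i) m (glue m βs) ≡ isNonempty (lookup βs (suc i))
laterDescent-glue {suc s} m (β ∷ βs) l<m i
  rewrite laterDescent-++ʳ (toℕ i) β {m ∷ glue m βs} (below∌ (l<m ∘ ∈-++⁺ˡ)) with i | βs
... | zero   | βs@(β′ ∷ _) rewrite ≡ᵇ-refl m = startsBelow-glue m βs (l<m ∘ ∈-++⁺ʳ β)
... | suc i′ | βs rewrite ≡ᵇ-refl m = laterDescent-glue m βs (l<m ∘ ∈-++⁺ʳ β) i′

-- Block 0 precedes the first `m` and block i follows the ith `m`, so block i decides type i. An
-- empty block leaves another `m` or an end of the word as neighbour, which is not smaller.
isDescent-glue-top : ∀ {s} m (βs : Vec Word (suc (suc s))) → Below m (letters βs) →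
                     (i : Fin (suc (suc s))) →
                     isDescent (toℕ i) m (glue m βs) ≡ isNonempty (lookup βs i)
isDescent-glue-top m ([] ∷ βs) l<m zero =
  trans (isDescent-first m (m ∷ glue m βs)) (firstDescent-none m (glue m βs))
  where
  firstDescent-none : ∀ m w → firstDescent m false (m ∷ w) ≡ false
  firstDescent-none m w rewrite ≡ᵇ-refl m = refl
isDescent-glue-top m ((b ∷ β) ∷ βs) l<m zero = trans (isDescent-first m (b ∷ β ++ m ∷ glue m βs)) go
  where
  go : firstDescent m false (b ∷ β ++ m ∷ glue m βs) ≡ true
  go rewrite ≢⇒≡ᵇ-false (≢-sym (<⇒≢ (l<m (here refl)))) | <⇒<ᵇ-true (l<m (here refl)) =
    firstDescent-top β (l<m ∘ there ∘ ∈-++⁺ˡ)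
isDescent-glue-top m βs l<m (suc i) =
  trans (isDescent-later (toℕ i) m (glue m βs)) (laterDescent-glue m βs l<m i)

-- Gluing: counts, splitting and the pattern condition

count-∉ : ∀ {a} w → a ∉ w → count a w ≡ 0
count-∉ []      a∉w = refl
count-∉ {a} (b ∷ w) a∉w rewrite ≢⇒≡ᵇ-false {a} {b} (a∉w ∘ here) = count-∉ w (a∉w ∘ there)

count-++ : ∀ a u v → count a (u ++ v) ≡ count a u + count a v
count-++ a []      v = refl
count-++ a (b ∷ u) v rewrite count-++ a u v = sym (+-assoc (if a ≡ᵇ b then 1 else 0) _ _)

count-glue : ∀ {s a m} (βs : Vec Word (suc s)) → a ≢ m → count a (glue m βs) ≡ count a (letters βs)
count-glue {zero}  {a} (β ∷ []) a≢m = trans (sym (+-identityʳ _)) (sym (count-++ a β []))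
count-glue {suc s} {a} {m} (β ∷ βs) a≢m
  rewrite count-++ a β (m ∷ glue m βs) | count-++ a β (letters βs) | ≢⇒≡ᵇ-false a≢m
        | count-glue βs a≢m = refl

count-glue-top : ∀ {s m} (βs : Vec Word (suc s)) → m ∉ letters βs → count m (glue m βs) ≡ s
count-glue-top {zero}  (β ∷ []) m∉ = count-∉ β (m∉ ∘ ∈-++⁺ˡ)
count-glue-top {suc s} {m} (β ∷ βs) m∉
  rewrite count-++ m β (m ∷ glue m βs) | count-∉ β (m∉ ∘ ∈-++⁺ˡ) | ≡ᵇ-refl m =
  cong suc (count-glue-top βs (m∉ ∘ ∈-++⁺ʳ β))

glue-cons : ∀ {s} m b (βs : Vec Word (suc s)) →
            glue m ((b ∷ Vec.head βs) ∷ Vec.tail βs) ≡ b ∷ glue m βs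
glue-cons {zero}  m b (β ∷ []) = refl
glue-cons {suc s} m b (β ∷ βs) = refl

unglue : ∀ {s} m w → count m w ≡ s →
         Σ (Vec Word (suc s)) λ βs → glue m βs ≡ w × m ∉ letters βs
unglue m []      refl = ([] ∷ []) , refl , λ ()
unglue m (b ∷ w) eq with m ≟ b
unglue m (b ∷ w) eq | yes refl rewrite ≡ᵇ-refl m with unglue m w refl
unglue m (b ∷ w) refl | yes refl | βs , eq′ , m∉ = [] ∷ βs , cong (m ∷_) eq′ , m∉
unglue m (b ∷ w) eq | no m≢b rewrite ≢⇒≡ᵇ-false m≢b with unglue m w eq
unglue m (b ∷ w) eq | no m≢b | βs@(_ ∷ _) , eq′ , m∉ =
  (b ∷ Vec.head βs) ∷ Vec.tail βs , trans (glue-cons m b βs) (cong (b ∷_) eq′) , ∉-∷ m≢b m∉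

splitAt-++ : ∀ {m} u v → m ∉ u → splitAt m (u ++ m ∷ v) ≡ u ∷ splitAt m v
splitAt-++ {m} [] v m∉u with splitAt m v in eq
... | []     = ⊥-elim (splitAt-nonempty m v eq)
  where
  splitAt-nonempty : ∀ m v → splitAt m v ≢ []
  splitAt-nonempty m (b ∷ v) with splitAt m v
  ... | []    = λ ()
  ... | _ ∷ _ with m ≡ᵇ b
  ... | true  = λ ()
  ... | false = λ ()
... | w ∷ ws rewrite ≡ᵇ-refl m = refl
splitAt-++ {m} (b ∷ u) v m∉u
  rewrite splitAt-++ u v (m∉u ∘ there) | ≢⇒≡ᵇ-false {m} {b} (m∉u ∘ here) = refl

splitAt-∉ : ∀ {m} u → m ∉ u → splitAt m u ≡ u ∷ []
splitAt-∉ []      m∉u = refl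
splitAt-∉ {m} (b ∷ u) m∉u
  rewrite splitAt-∉ u (m∉u ∘ there) | ≢⇒≡ᵇ-false {m} {b} (m∉u ∘ here) = refl

splitAt-glue : ∀ {s m} (βs : Vec Word (suc s)) → m ∉ letters βs → splitAt m (glue m βs) ≡ toList βs
splitAt-glue {zero}  (β ∷ []) m∉ = splitAt-∉ β (m∉ ∘ ∈-++⁺ˡ)
splitAt-glue {suc s} (β ∷ βs) m∉ = trans (splitAt-++ β (glue _ βs) (m∉ ∘ ∈-++⁺ˡ))
  (cong (β ∷_) (splitAt-glue βs (m∉ ∘ ∈-++⁺ʳ β)))

-- The pattern condition and disjointness of letters.

PatFrom : ℕ → Word → Set
PatFrom a []      = ⊤
PatFrom a (b ∷ w) = (a ∈ w → b ≤ a) × PatFrom a w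

Pat : Word → Set
Pat []      = ⊤
Pat (a ∷ w) = PatFrom a w × Pat w

patFrom-++⁻ : ∀ {a} u {v} → PatFrom a (u ++ v) → PatFrom a u
patFrom-++⁻ []      _       = tt
patFrom-++⁻ (b ∷ u) (h , p) = h ∘ ∈-++⁺ˡ , patFrom-++⁻ u p

pat-++⁻ˡ : ∀ u {v} → Pat (u ++ v) → Pat u
pat-++⁻ˡ []      _       = tt
pat-++⁻ˡ (a ∷ u) (h , p) = patFrom-++⁻ u h , pat-++⁻ˡ u p

pat-++⁻ʳ : ∀ u {v} → Pat (u ++ v) → Pat v
pat-++⁻ʳ []      p       = p
pat-++⁻ʳ (a ∷ u) (_ , p) = pat-++⁻ʳ u p

patFrom-between : ∀ {a m} u {v} → PatFrom a (u ++ m ∷ v) → a ∈ v → m ≤ a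
patFrom-between []      (h , _) a∈v = h a∈v
patFrom-between (b ∷ u) (_ , p) a∈v = patFrom-between u p a∈v

pat-between : ∀ {a m} u {v} → Pat (u ++ m ∷ v) → a ∈ u → a ∈ v → m ≤ a
pat-between (a ∷ u) (h , p) (here refl) a∈v = patFrom-between u h a∈v
pat-between (b ∷ u) (h , p) (there a∈u) a∈v = pat-between u p a∈u a∈v

patFrom-∉ : ∀ {a} v → a ∉ v → PatFrom a v
patFrom-∉ []      a∉v = tt
patFrom-∉ (b ∷ v) a∉v = (λ a∈ → ⊥-elim (a∉v (there a∈))) , patFrom-∉ v (a∉v ∘ there)

patFrom-max : ∀ {m} v → (∀ {y} → y ∈ v → y ≤ m) → PatFrom m v
patFrom-max []      v≤m = tt
patFrom-max (b ∷ v) v≤m = (λ _ → v≤m (here refl)) , patFrom-max v (v≤m ∘ there)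

patFrom-++⁺ : ∀ {a} u {v} → a ∉ v → PatFrom a u → PatFrom a (u ++ v)
patFrom-++⁺ []      a∉v _       = patFrom-∉ _ a∉v
patFrom-++⁺ (b ∷ u) a∉v (h , p) = h′ , patFrom-++⁺ u a∉v p
  where
  h′ : _ ∈ u ++ _ → b ≤ _
  h′ a∈ with ∈-++⁻ u a∈
  ... | inj₁ a∈u = h a∈u
  ... | inj₂ a∈v = ⊥-elim (a∉v a∈v)

pat-++⁺ : ∀ u {v} → Disj u v → Pat u → Pat v → Pat (u ++ v)
pat-++⁺ []      dis pu       pv = pv
pat-++⁺ (a ∷ u) dis (h , pu) pv = patFrom-++⁺ u (dis (here refl)) h , pat-++⁺ u (dis ∘ there) pu pv

pat-concat⁺ : ∀ t → Separated t → All Pat t → Pat (concat t)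
pat-concat⁺ []      _           []       = tt
pat-concat⁺ (α ∷ t) (dis , sep) (p ∷ ps) = pat-++⁺ α dis p (pat-concat⁺ t sep ps)

pat-concat⁻ : ∀ t → Pat (concat t) → All Pat t
pat-concat⁻ []      p = []
pat-concat⁻ (α ∷ t) p = pat-++⁻ˡ α p ∷ pat-concat⁻ t (pat-++⁻ʳ α p)

disj-glue : ∀ {s u m} (βs : Vec Word (suc s)) → m ∉ u → Disj u (letters βs) → Disj u (glue m βs)
disj-glue βs m∉u dis y∈u y∈g with ∈-glue⁻ _ βs y∈g
... | inj₁ refl = m∉u y∈u
... | inj₂ y∈l  = dis y∈u y∈l

glue-≤ : ∀ {s m} (βs : Vec Word (suc s)) → Below m (letters βs) → ∀ {y} → y ∈ glue m βs → y ≤ m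
glue-≤ βs l<m y∈ with ∈-glue⁻ _ βs y∈
... | inj₁ refl = ≤-refl
... | inj₂ y∈l  = <⇒≤ (l<m y∈l)

pat-glue⁺ : ∀ {s m} (βs : Vec Word (suc s)) → Below m (letters βs) → Separated (toList βs) →
            All Pat (toList βs) → Pat (glue m βs)
pat-glue⁺ {zero}  (β ∷ []) l<m sep (p ∷ []) = p
pat-glue⁺ {suc s} {m} (β ∷ βs) l<m (dis , sep) (p ∷ ps) =
  pat-++⁺ β dis′ p (patFrom-max (glue m βs) (glue-≤ βs (l<m ∘ ∈-++⁺ʳ β))
                   , pat-glue⁺ βs (l<m ∘ ∈-++⁺ʳ β) sep ps)
  where
  dis′ : Disj β (m ∷ glue m βs)
  dis′ y∈β (here refl) = below∌ (l<m ∘ ∈-++⁺ˡ) y∈β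
  dis′ y∈β (there y∈g) = disj-glue βs (below∌ (l<m ∘ ∈-++⁺ˡ)) dis y∈β y∈g

-- Disjointness of the blocks comes from the pattern condition: a letter present in two blocks would
-- enclose a copy of `m`, forcing `m` to be at most that letter.
pat-glue⁻ : ∀ {s m} (βs : Vec Word (suc s)) → Below m (letters βs) → Pat (glue m βs) →
            All Pat (toList βs) × Separated (toList βs)
pat-glue⁻ {zero}  (β ∷ []) l<m p = p ∷ [] , (λ _ ()) , tt
pat-glue⁻ {suc s} {m} (β ∷ βs) l<m p =
  let ps , sep = pat-glue⁻ βs (l<m ∘ ∈-++⁺ʳ β) (proj₂ (pat-++⁻ʳ β p)) in
  pat-++⁻ˡ β p ∷ ps ,
  (λ y∈β y∈l → <⇒≱ (l<m (∈-++⁺ˡ y∈β)) (pat-between β p y∈β (∈-glue⁺ m βs y∈l))) , sep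

separated-++⁺ : ∀ s {t} → Separated s → Separated t → Disj (concat s) (concat t) → Separated (s ++ t)
separated-++⁺ []      _           sept dis = sept
separated-++⁺ (α ∷ s) {t} (d , sep) sept dis = d′ , separated-++⁺ s sep sept (dis ∘ ∈-++⁺ʳ α)
  where
  d′ : Disj α (concat (s ++ t))
  d′ y∈α y∈ with ∈-++⁻ (concat s) (subst (_ ∈_) (sym (concat-++ s t)) y∈)
  ... | inj₁ y∈s = d y∈α y∈s
  ... | inj₂ y∈t = dis (∈-++⁺ˡ y∈α) y∈t

separated-++⁻ : ∀ s {t} → Separated (s ++ t) →
                Separated s × Separated t × Disj (concat s) (concat t)
separated-++⁻ []      sept    = tt , sept , λ ()
separated-++⁻ (α ∷ s) {t} (d , sep) =
  let seps , sept , dis = separated-++⁻ s sep in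
  ((λ y∈α y∈s → d′ y∈α (∈-++⁺ˡ y∈s)) , seps) , sept ,
  λ y∈ y∈t → [ (λ y∈α → d′ y∈α (∈-++⁺ʳ (concat s) y∈t)) , (λ y∈s → dis y∈s y∈t) ]′ (∈-++⁻ α y∈)
  where
  d′ : Disj α (concat s ++ concat t)
  d′ y∈α y∈ = d y∈α (subst (_ ∈_) (concat-++ s t) y∈)

nonempties : List Word → List Word
nonempties []            = []
nonempties ([] ∷ t)      = nonempties t
nonempties ((b ∷ β) ∷ t) = (b ∷ β) ∷ nonempties t

concat-nonempties : ∀ t → concat (nonempties t) ≡ concat t
concat-nonempties []            = refl
concat-nonempties ([] ∷ t)      = concat-nonempties t
concat-nonempties ((b ∷ β) ∷ t) = cong ((b ∷ β) ++_) (concat-nonempties t)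

separated-nonempties⁺ : ∀ t → Separated t → Separated (nonempties t)
separated-nonempties⁺ []            _         = tt
separated-nonempties⁺ ([] ∷ t)      (_ , sep) = separated-nonempties⁺ t sep
separated-nonempties⁺ ((b ∷ β) ∷ t) (d , sep) =
  (λ y∈ → subst (_ ∉_) (sym (concat-nonempties t)) (d y∈)) , separated-nonempties⁺ t sep

separated-nonempties⁻ : ∀ t → Separated (nonempties t) → Separated t
separated-nonempties⁻ []            _         = tt
separated-nonempties⁻ ([] ∷ t)      sep       = (λ ()) , separated-nonempties⁻ t sep
separated-nonempties⁻ ((b ∷ β) ∷ t) (d , sep) =
  (λ y∈ → subst (_ ∉_) (concat-nonempties t) (d y∈)) , separated-nonempties⁻ t sep

pat-nonempties⁺ : ∀ t → All Pat t → All Pat (nonempties t)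
pat-nonempties⁺ []            ps       = []
pat-nonempties⁺ ([] ∷ t)      (_ ∷ ps) = pat-nonempties⁺ t ps
pat-nonempties⁺ ((b ∷ β) ∷ t) (p ∷ ps) = p ∷ pat-nonempties⁺ t ps

pat-nonempties⁻ : ∀ t → All Pat (nonempties t) → All Pat t
pat-nonempties⁻ []            ps       = []
pat-nonempties⁻ ([] ∷ t)      ps       = tt ∷ pat-nonempties⁻ t ps
pat-nonempties⁻ ((b ∷ β) ∷ t) (p ∷ ps) = p ∷ pat-nonempties⁻ t ps

all-nonempty : ∀ t → All (_≢ []) (nonempties t)
all-nonempty []            = []
all-nonempty ([] ∷ t)      = all-nonempty t
all-nonempty ((b ∷ β) ∷ t) = (λ ()) ∷ all-nonempty t

anyB-nonempties : (p : Word → Bool) → p [] ≡ false → ∀ t → anyB p (nonempties t) ≡ anyB p t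
anyB-nonempties p p[] []            = refl
anyB-nonempties p p[] ([] ∷ t)      rewrite p[] = anyB-nonempties p p[] t
anyB-nonempties p p[] ((b ∷ β) ∷ t) = cong (p (b ∷ β) ∨_) (anyB-nonempties p p[] t)

-- Stack sorting

∈-count : ∀ {a} w → a ∈ w → ∃ λ s → count a w ≡ suc s
∈-count {a} (b ∷ w) a∈ with a ≟ b
... | yes refl rewrite ≡ᵇ-refl a = _ , refl
∈-count {a} (b ∷ w) (here a≡b) | no a≢b = ⊥-elim (a≢b a≡b)
∈-count {a} (b ∷ w) (there a∈) | no a≢b rewrite ≢⇒≡ᵇ-false a≢b = ∈-count w a∈

length-glue-≤ : ∀ {s} m (βs : Vec Word (suc s)) → All (λ β → length β ≤ length (glue m βs)) (toList βs)
length-glue-≤ {zero}  m (β ∷ []) = ≤-refl ∷ []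
length-glue-≤ {suc s} m (β ∷ βs) = length-++-≤ˡ β ∷
  All.map (λ le → ≤-trans le (≤-trans (n≤1+n _) (length-++-≤ʳ (m ∷ glue m βs) {β}))) (length-glue-≤ m βs)

length-glue-< : ∀ {s} m (βs : Vec Word (suc (suc s))) →
                All (λ β → length β < length (glue m βs)) (toList βs)
length-glue-< m (β ∷ βs) =
  subst (length β <_) (sym (trans (length-++ β) (+-suc (length β) _))) (s≤s (m≤m+n _ _)) ∷
  All.map (λ le → ≤-trans (s≤s le) (length-++-≤ʳ (m ∷ glue m βs) {β})) (length-glue-≤ m βs)

maxW-∈ : ∀ a w → maxW (a ∷ w) ∈ a ∷ w
maxW-∈ a []      = here (⊔-identityʳ a)
maxW-∈ a (b ∷ w) with ⊔-sel a (maxW (b ∷ w))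
... | inj₁ eq = here eq
... | inj₂ eq = there (subst (_∈ b ∷ w) (sym eq) (maxW-∈ b w))

maxW-upper : ∀ {y} w → y ∈ w → y ≤ maxW w
maxW-upper (a ∷ w) (here refl) = m≤m⊔n a (maxW w)
maxW-upper (a ∷ w) (there y∈w) = ≤-trans (maxW-upper w y∈w) (m≤n⊔m a (maxW w))

-- At least two blocks means at least one copy of `m`, so every block is strictly shorter than `w`.
-- This is what makes the fuel arguments go through.
record TopSplit (m : ℕ) (w : Word) : Set where
  constructor topSplit
  field
    {extra} : ℕ
    blocks  : Vec Word (suc (suc extra))
    glued   : glue m blocks ≡ w
    m∉      : m ∉ letters blocks

split-∈ : ∀ {m} w → m ∈ w → TopSplit m w
split-∈ w m∈w with ∈-count w m∈w
... | s , eq with unglue _ w eq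
... | βs , glued , m∉ = topSplit βs glued m∉

splitAt-shorter : ∀ {m} w → m ∈ w → All (λ u → length u < length w) (splitAt m w)
splitAt-shorter w m∈w with split-∈ w m∈w
... | topSplit βs refl m∉ rewrite splitAt-glue βs m∉ = length-glue-< _ βs

-- `S` uses the length of its argument as fuel, but the recursion sorts all blocks with one common
-- fuel. Only independence of the fuel turns the recursive calls back into `S`.
stackSortF-fuel : ∀ f g w → length w ≤ f → length w ≤ g → stackSortF f w ≡ stackSortF g w
stackSortF-fuel f g [] _ _ = refl
stackSortF-fuel (suc f) (suc g) (a ∷ w) (s≤s w≤f) (s≤s w≤g) =
  cong (λ us → concat us ++ [ maxW (a ∷ w) ])
    (map-cong-local (All.map (λ { {u} (s≤s u≤w) → stackSortF-fuel f g u (≤-trans u≤w w≤f) (≤-trans u≤w w≤g) })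
                             (splitAt-shorter (a ∷ w) (maxW-∈ a w))))

S-top : ∀ {m} w → m ∈ w → (∀ {y} → y ∈ w → y ≤ m) → S w ≡ concat (map S (splitAt m w)) ++ [ m ]
S-top {m} (a ∷ w) m∈ ≤m
  rewrite ≤-antisym (≤m (maxW-∈ a w)) (maxW-upper (a ∷ w) m∈) =
  cong (λ us → concat us ++ [ m ])
    (map-cong-local (All.map (λ { {u} (s≤s u≤w) → stackSortF-fuel (length w) (length u) u u≤w ≤-refl })
                             (splitAt-shorter (a ∷ w) m∈)))

S-glue : ∀ {s m} (βs : Vec Word (suc (suc s))) → Below m (letters βs) →
         S (glue m βs) ≡ concat (map S (toList βs)) ++ [ m ]
S-glue {m = m} βs l<m = trans (S-top (glue m βs) (top∈glue m βs) (glue-≤ βs l<m))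
  (cong (λ us → concat (map S us) ++ [ m ]) (splitAt-glue βs (below∌ l<m)))

-- This form serves the second pass: after the first pass the largest letter occurs only once, so
-- there are just two blocks.
S-max : ∀ {m} u v → Below m u → Below m v → S (u ++ m ∷ v) ≡ (S u ++ S v) ++ [ m ]
S-max {m} u v u<m v<m = trans (S-glue (u ∷ v ∷ []) l<m)
  (cong (λ z → (S u ++ z) ++ [ m ]) (++-identityʳ (S v)))
  where
  l<m : Below m (u ++ v ++ [])
  l<m y∈ with ∈-++⁻ u y∈
  ... | inj₁ y∈u = u<m y∈u
  ... | inj₂ y∈v = v<m (subst (_ ∈_) (++-identityʳ v) y∈v)

∈-concat-map⁻ : ∀ {y} {f : Word → Word} {ts} → All (λ α → y ∈ f α → y ∈ α) ts →
                y ∈ concat (map f ts) → y ∈ concat ts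
∈-concat-map⁻ {f = f} {α ∷ ts} (h ∷ hs) y∈ with ∈-++⁻ (f α) y∈
... | inj₁ y∈α = ∈-++⁺ˡ (h y∈α)
... | inj₂ y∈t = ∈-++⁺ʳ α (∈-concat-map⁻ hs y∈t)

∈-concat-map⁺ : ∀ {y} {f : Word → Word} {ts} → All (λ α → y ∈ α → y ∈ f α) ts →
                y ∈ concat ts → y ∈ concat (map f ts)
∈-concat-map⁺ {f = f} {α ∷ ts} (h ∷ hs) y∈ with ∈-++⁻ α y∈
... | inj₁ y∈α = ∈-++⁺ˡ (h y∈α)
... | inj₂ y∈t = ∈-++⁺ʳ (f α) (∈-concat-map⁺ hs y∈t)

∈-stackSortF⁻ : ∀ {y} f w → y ∈ stackSortF f w → y ∈ w
∈-stackSortF⁻ zero    []      ()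
∈-stackSortF⁻ (suc f) (a ∷ w) y∈
  with ∈-++⁻ (concat (map (stackSortF f) (splitAt (maxW (a ∷ w)) (a ∷ w)))) y∈
... | inj₂ (here refl) = maxW-∈ a w
... | inj₁ y∈us with split-∈ (a ∷ w) (maxW-∈ a w)
... | topSplit βs glued m∉ = subst (_ ∈_) glued
  (∈-glue⁺ _ βs (subst (λ us → _ ∈ concat us)
    (trans (cong (splitAt (maxW (a ∷ w))) (sym glued)) (splitAt-glue βs m∉))
    (∈-concat-map⁻ {f = stackSortF f} {splitAt (maxW (a ∷ w)) (a ∷ w)}
      (All.universal (λ u → ∈-stackSortF⁻ f u) _) y∈us)))

∈-stackSortF⁺ : ∀ {y} f w → length w ≤ f → y ∈ w → y ∈ stackSortF f w
∈-stackSortF⁺ {y} (suc f) (a ∷ w) (s≤s w≤f) y∈ with split-∈ (a ∷ w) (maxW-∈ a w)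
... | topSplit βs glued m∉ with ∈-glue⁻ (maxW (a ∷ w)) βs (subst (y ∈_) (sym glued) y∈)
... | inj₁ refl = ∈-++⁺ʳ (concat (map (stackSortF f) (splitAt y (a ∷ w)))) (here refl)
... | inj₂ y∈l  = ∈-++⁺ˡ (∈-concat-map⁺ {f = stackSortF f} {splitAt (maxW (a ∷ w)) (a ∷ w)}
    (All.map (λ { {u} (s≤s u≤w) → ∈-stackSortF⁺ f u (≤-trans u≤w w≤f) })
             (splitAt-shorter (a ∷ w) (maxW-∈ a w)))
    (subst (λ us → y ∈ concat us)
           (sym (trans (cong (splitAt (maxW (a ∷ w))) (sym glued)) (splitAt-glue βs m∉))) y∈l))

∈-S⁻ : ∀ {y} w → y ∈ S w → y ∈ w
∈-S⁻ w = ∈-stackSortF⁻ (length w) w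

∈-S⁺ : ∀ {y} w → y ∈ w → y ∈ S w
∈-S⁺ w = ∈-stackSortF⁺ (length w) w ≤-refl

sorts : List Word → Word
sorts t = concat (map S t)

∈-sorts⁻ : ∀ {y} t → y ∈ sorts t → y ∈ concat t
∈-sorts⁻ t = ∈-concat-map⁻ {f = S} (All.universal (λ α → ∈-S⁻ α) t)

∈-sorts⁺ : ∀ {y} t → y ∈ concat t → y ∈ sorts t
∈-sorts⁺ t = ∈-concat-map⁺ {f = S} (All.universal (λ α → ∈-S⁺ α) t)

sorts-++ : ∀ s t → sorts (s ++ t) ≡ sorts s ++ sorts t
sorts-++ s t = trans (cong concat (map-++ S s t)) (sym (concat-++ (map S s) (map S t)))

sorts-nonempties : ∀ t → sorts (nonempties t) ≡ sorts t
sorts-nonempties []            = refl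
sorts-nonempties ([] ∷ t)      = sorts-nonempties t
sorts-nonempties ((b ∷ β) ∷ t) = cong (S (b ∷ β) ++_) (sorts-nonempties t)

-- The offset `lo` replaces standardisation: the right part of a cut lives on the upper letters and
-- is treated there, without being relabelled to 1, 2, and so on.
interval : ℕ → ℕ → Word
interval lo zero    = []
interval lo (suc n) = suc lo ∷ interval (suc lo) n

interval-applyUpTo : ∀ lo n (f : ℕ → ℕ) → (∀ i → f i ≡ suc (lo + i)) → interval lo n ≡ applyUpTo f n
interval-applyUpTo lo zero    f eq = refl
interval-applyUpTo lo (suc n) f eq = cong₂ _∷_ (sym (trans (eq 0) (cong suc (+-identityʳ lo))))
  (interval-applyUpTo (suc lo) n (f ∘ suc) (λ i → trans (eq (suc i)) (cong suc (+-suc lo i))))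

interval≡idWord : ∀ n → interval 0 n ≡ idWord n
interval≡idWord n = interval-applyUpTo 0 n suc (λ _ → refl)

interval-++ : ∀ lo p q → interval lo (p + q) ≡ interval lo p ++ interval (lo + p) q
interval-++ lo zero    q = cong (λ l → interval l q) (sym (+-identityʳ lo))
interval-++ lo (suc p) q = cong (suc lo ∷_) (trans (interval-++ (suc lo) p q)
  (cong (λ l → interval (suc lo) p ++ interval l q) (sym (+-suc lo p))))

interval-snoc : ∀ lo n → interval lo (suc n) ≡ interval lo n ++ [ suc (lo + n) ]
interval-snoc lo n = trans (cong (interval lo) (sym (+-comm n 1))) (interval-++ lo n 1)

-- This recovers the sizes of the two sides of a cut from the sorted word alone, with nothing
-- assumed about which letters each side uses.
interval-++⁻ : ∀ u {v} lo n → u ++ v ≡ interval lo n →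
               ∃₂ λ p q → p + q ≡ n × u ≡ interval lo p × v ≡ interval (lo + p) q
interval-++⁻ []      lo n       eq =
  0 , n , refl , refl , trans eq (cong (λ l → interval l n) (sym (+-identityʳ lo)))
interval-++⁻ (b ∷ u) lo (suc n) eq with ∷-injective eq
... | refl , eq′ with interval-++⁻ u (suc lo) n eq′
... | p , q , refl , refl , refl = suc p , q , refl , refl , cong (λ l → interval l q) (sym (+-suc lo p))

∈-interval⁻ : ∀ {y} lo n → y ∈ interval lo n → lo < y × y ≤ lo + n
∈-interval⁻ lo (suc n) (here refl) = ≤-refl , subst (suc lo ≤_) (sym (+-suc lo n)) (s≤s (m≤m+n lo n))
∈-interval⁻ {y} lo (suc n) (there y∈) with ∈-interval⁻ (suc lo) n y∈
... | lo<y , y≤ = <⇒≤ lo<y , subst (y ≤_) (sym (+-suc lo n)) y≤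

∈-interval⁺ : ∀ {y} lo n → lo < y → y ≤ lo + n → y ∈ interval lo n
∈-interval⁺ {y} lo zero    lo<y y≤ = ⊥-elim (<⇒≱ lo<y (subst (y ≤_) (+-identityʳ lo) y≤))
∈-interval⁺ {y} lo (suc n) lo<y y≤ with y ≟ suc lo
... | yes eq = here eq
... | no neq = there (∈-interval⁺ (suc lo) n (≤∧≢⇒< lo<y (≢-sym neq)) (subst (y ≤_) (+-suc lo n) y≤))

length-interval : ∀ lo n → length (interval lo n) ≡ n
length-interval lo zero    = refl
length-interval lo (suc n) = cong suc (length-interval (suc lo) n)

-- Cutting a tuple at its largest letter

-- The letter set is encoded in `sorted`: since `S` preserves the set of letters, the letters of `t`
-- are exactly lo + 1, ..., lo + n (`letters⁻`, `letters⁺`).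
record Good (r lo n : ℕ) (t : List Word) : Set where
  field
    nonempty : All (_≢ []) t
    pat      : All Pat t
    sep      : Separated t
    cnt      : ∀ {y} → y ∈ concat t → count y (concat t) ≡ r
    sorted   : S (sorts t) ≡ interval lo n

letters⁻ : ∀ {y lo n} t → S (sorts t) ≡ interval lo n → y ∈ concat t → lo < y × y ≤ lo + n
letters⁻ t sorted y∈ =
  ∈-interval⁻ _ _ (subst (_ ∈_) sorted (∈-S⁺ (sorts t) (∈-sorts⁺ t y∈)))

letters⁺ : ∀ {y lo n} t → S (sorts t) ≡ interval lo n → lo < y → y ≤ lo + n → y ∈ concat t
letters⁺ t sorted lo<y y≤ =
  ∈-sorts⁻ t (∈-S⁻ (sorts t) (subst (_ ∈_) (sym sorted) (∈-interval⁺ _ _ lo<y y≤)))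

-- No hypotheses on the pieces, so that assembling and cutting, which start from different
-- knowledge, can share these facts.
module Node {s : ℕ} (m : ℕ) (αs : List Word) (βs : Vec Word (suc (suc s))) (γs : List Word) where
  x : Word
  x = glue m βs

  node left : List Word
  node = αs ++ x ∷ γs
  left = αs ++ nonempties (toList βs)

  concat-node : concat node ≡ concat αs ++ x ++ concat γs
  concat-node = sym (concat-++ αs (x ∷ γs))

  concat-left : concat left ≡ concat αs ++ letters βs
  concat-left = trans (sym (concat-++ αs _)) (cong (concat αs ++_) (concat-nonempties (toList βs)))

  left⁻ : ∀ {y} → y ∈ concat left → y ∈ concat αs ⊎ y ∈ letters βs
  left⁻ y∈ = ∈-++⁻ (concat αs) (subst (_ ∈_) concat-left y∈)

  αs⊆left : ∀ {y} → y ∈ concat αs → y ∈ concat left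
  αs⊆left y∈ = subst (_ ∈_) (sym concat-left) (∈-++⁺ˡ y∈)

  βs⊆left : ∀ {y} → y ∈ letters βs → y ∈ concat left
  βs⊆left y∈ = subst (_ ∈_) (sym concat-left) (∈-++⁺ʳ (concat αs) y∈)

  node⁻ : ∀ {y} → y ∈ concat node → y ≡ m ⊎ y ∈ concat left ⊎ y ∈ concat γs
  node⁻ y∈ with ∈-++⁻ (concat αs) (subst (_ ∈_) concat-node y∈)
  ... | inj₁ y∈αs = inj₂ (inj₁ (αs⊆left y∈αs))
  ... | inj₂ y∈xγs with ∈-++⁻ x y∈xγs
  ... | inj₂ y∈γs = inj₂ (inj₂ y∈γs)
  ... | inj₁ y∈x with ∈-glue⁻ m βs y∈x
  ... | inj₁ y≡m = inj₁ y≡m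
  ... | inj₂ y∈l = inj₂ (inj₁ (βs⊆left y∈l))

  αs⊆node : ∀ {y} → y ∈ concat αs → y ∈ concat node
  αs⊆node y∈ = subst (_ ∈_) (sym concat-node) (∈-++⁺ˡ y∈)

  x⊆node : ∀ {y} → y ∈ x → y ∈ concat node
  x⊆node y∈ = subst (_ ∈_) (sym concat-node) (∈-++⁺ʳ (concat αs) (∈-++⁺ˡ y∈))

  γs⊆node : ∀ {y} → y ∈ concat γs → y ∈ concat node
  γs⊆node y∈ = subst (_ ∈_) (sym concat-node) (∈-++⁺ʳ (concat αs) (∈-++⁺ʳ x y∈))

  left⊆node : ∀ {y} → y ∈ concat left → y ∈ concat node
  left⊆node y∈ with left⁻ y∈
  ... | inj₁ y∈αs = αs⊆node y∈αs
  ... | inj₂ y∈l  = x⊆node (∈-glue⁺ m βs y∈l)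

  count-node : ∀ y → count y (concat node) ≡ count y (concat αs) + (count y x + count y (concat γs))
  count-node y rewrite concat-node | count-++ y (concat αs) (x ++ concat γs)
                     | count-++ y x (concat γs) = refl

  count-node-≢ : ∀ {y} → y ≢ m → count y (concat node) ≡ count y (concat left) + count y (concat γs)
  count-node-≢ {y} y≢m rewrite count-node y | count-glue βs y≢m | concat-left
                             | count-++ y (concat αs) (letters βs) = sym (+-assoc (count y (concat αs)) _ _)

  sorts-node : Below m (letters βs) → sorts node ≡ sorts left ++ m ∷ sorts γs
  sorts-node l<m = begin
    sorts node                                          ≡⟨ sorts-++ αs (x ∷ γs) ⟩
    sorts αs ++ S x ++ sorts γs                         ≡⟨ cong (λ z → sorts αs ++ z ++ sorts γs) (S-glue βs l<m) ⟩
    sorts αs ++ (sorts B ++ [ m ]) ++ sorts γs          ≡⟨ cong (sorts αs ++_) (++-assoc (sorts B) _ _) ⟩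
    sorts αs ++ sorts B ++ m ∷ sorts γs                 ≡⟨ sym (++-assoc (sorts αs) _ _) ⟩
    (sorts αs ++ sorts B) ++ m ∷ sorts γs               ≡⟨ cong (_++ m ∷ sorts γs) (sym sorts-left) ⟩
    sorts left ++ m ∷ sorts γs ∎
    where
    open ≡-Reasoning
    B : List Word
    B = toList βs
    sorts-left : sorts left ≡ sorts αs ++ sorts B
    sorts-left = trans (sorts-++ αs _) (cong (sorts αs ++_) (sorts-nonempties B))

  S-node : Below m (concat left) → Below m (concat γs) →
           S (sorts node) ≡ (S (sorts left) ++ S (sorts γs)) ++ [ m ]
  S-node left<m γs<m = trans (cong S (sorts-node (left<m ∘ βs⊆left)))
    (S-max (sorts left) (sorts γs) (left<m ∘ ∈-sorts⁻ left) (γs<m ∘ ∈-sorts⁻ γs))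

++-nonempty : ∀ (u : Word) {b v} → u ++ b ∷ v ≢ []
++-nonempty []      ()
++-nonempty (_ ∷ _) ()

module _ {r : ℕ} {lo p q : ℕ} {αs : List Word} {βs : Vec Word (suc (suc r))} {γs : List Word} where
  open Node (suc (lo + (p + q))) αs βs γs

  left-bound : S (sorts left) ≡ interval lo p → Below (suc (lo + (p + q))) (concat left)
  left-bound sorted y∈ = s≤s (≤-trans (proj₂ (letters⁻ left sorted y∈)) (+-monoʳ-≤ lo (m≤m+n p q)))

  right-bound : S (sorts γs) ≡ interval (lo + p) q → Below (suc (lo + (p + q))) (concat γs)
  right-bound sorted {y} y∈ = s≤s (subst (y ≤_) (+-assoc lo p q) (proj₂ (letters⁻ γs sorted y∈)))

  left-right-disj : S (sorts left) ≡ interval lo p → S (sorts γs) ≡ interval (lo + p) q →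
                    Disj (concat left) (concat γs)
  left-right-disj sl sr y∈l y∈r = <⇒≱ (proj₁ (letters⁻ γs sr y∈r)) (proj₂ (letters⁻ left sl y∈l))

  -- The sorted halves are consecutive intervals, so their letters are disjoint and all lie below
  -- `m`. The pattern and the counts then combine piece by piece, and the second pass yields the two
  -- intervals followed by `m`.
  compose : Good (suc r) lo p left → Good (suc r) (lo + p) q γs → Good (suc r) lo (suc (p + q)) node
  compose gl gr = record
    { nonempty = All.++⁺ (All.++⁻ˡ αs L.nonempty) (x-nonempty βs ∷ R.nonempty)
    ; pat      = All.++⁺ (All.++⁻ˡ αs L.pat)
                   (pat-glue⁺ βs l<m sepβ (pat-nonempties⁻ (toList βs) (All.++⁻ʳ αs L.pat)) ∷ R.pat)
    ; sep      = separated-++⁺ αs sepα (x#γs , R.sep) αs#rest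
    ; cnt      = cnt′
    ; sorted   = trans (S-node left<m γs<m)
                   (trans (cong₂ (λ u v → (u ++ v) ++ [ m ]) L.sorted R.sorted)
                   (trans (cong (_++ [ m ]) (sym (interval-++ lo p q))) (sym (interval-snoc lo (p + q)))))
    }
    where
    module L = Good gl
    module R = Good gr
    m : ℕ
    m = suc (lo + (p + q))
    left<m : Below m (concat left)
    left<m = left-bound L.sorted
    γs<m : Below m (concat γs)
    γs<m = right-bound R.sorted
    l<m : Below m (letters βs)
    l<m = left<m ∘ βs⊆left
    x-nonempty : ∀ {s} (βs : Vec Word (suc (suc s))) → glue m βs ≢ []
    x-nonempty (β ∷ βs) = ++-nonempty β
    left#γs : Disj (concat left) (concat γs)
    left#γs = left-right-disj L.sorted R.sorted
    sepα : Separated αs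
    sepα = proj₁ (separated-++⁻ αs L.sep)
    sepβ : Separated (toList βs)
    sepβ = separated-nonempties⁻ (toList βs) (proj₁ (proj₂ (separated-++⁻ αs L.sep)))
    αs#βs : Disj (concat αs) (letters βs)
    αs#βs y∈αs = subst (_ ∉_) (concat-nonempties (toList βs))
                   (proj₂ (proj₂ (separated-++⁻ αs L.sep)) y∈αs)
    x#γs : Disj x (concat γs)
    x#γs y∈x y∈γs with ∈-glue⁻ m βs y∈x
    ... | inj₁ refl = below∌ γs<m y∈γs
    ... | inj₂ y∈l  = left#γs (βs⊆left y∈l) y∈γs
    αs#rest : Disj (concat αs) (x ++ concat γs)
    αs#rest y∈αs y∈ with ∈-++⁻ x y∈
    ... | inj₁ y∈x  = disj-glue βs (below∌ (left<m ∘ αs⊆left)) αs#βs y∈αs y∈x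
    ... | inj₂ y∈γs = left#γs (αs⊆left y∈αs) y∈γs
    cnt′ : ∀ {y} → y ∈ concat node → count y (concat node) ≡ suc r
    cnt′ {y} y∈ with node⁻ y∈
    ... | inj₁ refl rewrite count-node m | count-∉ (concat αs) (below∌ (left<m ∘ αs⊆left))
                          | count-∉ (concat γs) (below∌ γs<m) | count-glue-top βs (below∌ l<m) =
          +-identityʳ _
    ... | inj₂ (inj₁ y∈l) rewrite count-node-≢ (<⇒≢ (left<m y∈l)) | count-∉ (concat γs) (left#γs y∈l) =
          trans (+-identityʳ _) (L.cnt y∈l)
    ... | inj₂ (inj₂ y∈r) rewrite count-node-≢ (<⇒≢ (γs<m y∈r))
                                | count-∉ (concat left) (λ y∈l → left#γs y∈l y∈r) = R.cnt y∈r

∈-concat-first : ∀ {m : ℕ} (t : List Word) → m ∈ concat t →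
                 Σ (List Word) λ αs → Σ Word λ α → Σ (List Word) λ γs → t ≡ αs ++ α ∷ γs × m ∈ α
∈-concat-first (α ∷ t) m∈ with ∈-++⁻ α m∈
... | inj₁ m∈α = [] , α , t , refl , m∈α
... | inj₂ m∈t with ∈-concat-first t m∈t
... | αs , α′ , γs , refl , m∈α′ = α ∷ αs , α′ , γs , refl , m∈α′

-- Here letters occur `suc r` times, hence r + 2 blocks; `t` has n + 1 letters, so the largest is
-- `suc (lo + n)` and n letters are left for the two sides.
record Decomposition (r lo n : ℕ) (t : List Word) : Set where
  field
    {p q} : ℕ
    αs    : List Word
    βs    : Vec Word (suc (suc r))
    γs    : List Word
    size  : p + q ≡ n
    shape : t ≡ αs ++ glue (suc (lo + n)) βs ∷ γs
    goodˡ : Good (suc r) lo p (αs ++ nonempties (toList βs))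
    goodʳ : Good (suc r) (lo + p) q γs

-- `sorted` makes the largest letter occur, and separation puts all its copies into one component
-- `w`. Its count in `w` is therefore `suc r`, and `unglue` yields the blocks.
decompose : ∀ {r lo n t} → Good (suc r) lo (suc n) t → Decomposition r lo n t
decompose {r} {lo} {n} {t} g
  with ∈-concat-first t (letters⁺ {suc (lo + n)} t (Good.sorted g) (s≤s (m≤m+n lo n))
                                  (≤-reflexive (sym (+-suc lo n))))
... | αs , w , γs , refl , m∈w = go (unglue m w count-w)
  where
  open Good g
  m : ℕ
  m = suc (lo + n)
  seps : Separated αs × Separated (w ∷ γs) × Disj (concat αs) (w ++ concat γs)
  seps = separated-++⁻ αs sep
  αs#rest : Disj (concat αs) (w ++ concat γs)
  αs#rest = proj₂ (proj₂ seps)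
  w#γs : Disj w (concat γs)
  w#γs = proj₁ (proj₁ (proj₂ seps))
  concat-t : concat (αs ++ w ∷ γs) ≡ concat αs ++ w ++ concat γs
  concat-t = sym (concat-++ αs (w ∷ γs))
  m∉αs : m ∉ concat αs
  m∉αs m∈αs = αs#rest m∈αs (∈-++⁺ˡ m∈w)
  m∉γs : m ∉ concat γs
  m∉γs = w#γs m∈w
  count-w : count m w ≡ suc r
  count-w = begin
    count m w
      ≡⟨ sym (+-identityʳ _) ⟩
    count m w + 0
      ≡⟨ sym (cong₂ (λ a b → a + (count m w + b)) (count-∉ _ m∉αs) (count-∉ _ m∉γs)) ⟩
    count m (concat αs) + (count m w + count m (concat γs))
      ≡⟨ cong (count m (concat αs) +_) (sym (count-++ m w (concat γs))) ⟩
    count m (concat αs) + count m (w ++ concat γs)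
      ≡⟨ sym (count-++ m (concat αs) _) ⟩
    count m (concat αs ++ w ++ concat γs)
      ≡⟨ sym (cong (count m) concat-t) ⟩
    count m (concat (αs ++ w ∷ γs))
      ≡⟨ cnt (subst (m ∈_) (sym concat-t) (∈-++⁺ʳ (concat αs) (∈-++⁺ˡ m∈w))) ⟩
    suc r ∎
    where open ≡-Reasoning
  go : (Σ (Vec Word (suc (suc r))) λ βs → glue m βs ≡ w × m ∉ letters βs) →
       Decomposition r lo n (αs ++ w ∷ γs)
  go (βs , refl , m∉βs) = finish (interval-++⁻ (S (sorts left)) lo n split)
    where
    open Node m αs βs γs
    node<m : ∀ {y} → y ∈ concat node → y ≢ m → y < m
    node<m {y} y∈ y≢m = ≤∧≢⇒< (subst (y ≤_) (+-suc lo n) (proj₂ (letters⁻ node sorted y∈))) y≢m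
    left<m : Below m (concat left)
    left<m y∈ = node<m (left⊆node y∈) y≢m
      where
      y≢m : _ ≢ m
      y≢m refl with left⁻ y∈
      ... | inj₁ m∈αs = m∉αs m∈αs
      ... | inj₂ m∈βs = m∉βs m∈βs
    γs<m : Below m (concat γs)
    γs<m y∈ = node<m (γs⊆node y∈) λ { refl → m∉γs y∈ }
    -- Both descriptions of the sorted word end in `m`; dropping that letter leaves an interval that
    -- is visibly a concatenation, ready for `interval-++⁻`.
    split : S (sorts left) ++ S (sorts γs) ≡ interval lo n
    split = ∷ʳ-injectiveˡ _ _ (trans (sym (S-node left<m γs<m)) (trans sorted (interval-snoc lo n)))
    pat-x : All Pat (toList βs) × Separated (toList βs)
    pat-x = pat-glue⁻ βs (left<m ∘ βs⊆left) (All.head (All.++⁻ʳ αs pat))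
    finish : (∃₂ λ p q → p + q ≡ n × S (sorts left) ≡ interval lo p × S (sorts γs) ≡ interval (lo + p) q) →
             Decomposition r lo n node
    finish (p , q , refl , sortedˡ , sortedʳ) = record
      { αs = αs ; βs = βs ; γs = γs ; size = refl ; shape = refl
      ; goodˡ = record
        { nonempty = All.++⁺ (All.++⁻ˡ αs nonempty) (all-nonempty (toList βs))
        ; pat      = All.++⁺ (All.++⁻ˡ αs pat) (pat-nonempties⁺ (toList βs) (proj₁ pat-x))
        ; sep      = separated-++⁺ αs (proj₁ seps) (separated-nonempties⁺ (toList βs) (proj₂ pat-x))
                       (λ y∈αs y∈ → αs#rest y∈αs (∈-++⁺ˡ (∈-glue⁺ m βs
                         (subst (_ ∈_) (concat-nonempties (toList βs)) y∈))))
        ; cnt      = λ {y} y∈ → trans (sym (trans (count-node-≢ (<⇒≢ (left<m y∈)))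
                       (trans (cong (count y (concat left) +_) (count-∉ _ (left#γs y∈))) (+-identityʳ _))))
                       (cnt (left⊆node y∈))
        ; sorted   = sortedˡ }
      ; goodʳ = record
        { nonempty = All.tail (All.++⁻ʳ αs nonempty)
        ; pat      = All.tail (All.++⁻ʳ αs pat)
        ; sep      = proj₂ (proj₁ (proj₂ seps))
        ; cnt      = λ {y} y∈ → trans (sym (trans (count-node-≢ (<⇒≢ (γs<m y∈)))
                       (cong (_+ count y (concat γs)) (count-∉ (concat left) (λ y∈l → left#γs y∈l y∈)))))
                       (cnt (γs⊆node y∈))
        ; sorted   = sortedʳ } }
      where
      left#γs : Disj (concat left) (concat γs)
      left#γs = left-right-disj {r} {lo} {p} {q} {αs} {βs} {γs} sortedˡ sortedʳ

-- Weights under the cut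

filterB-++ : ∀ {A : Set} (p : A → Bool) xs ys → filterB p (xs ++ ys) ≡ filterB p xs ++ filterB p ys
filterB-++ p []       ys = refl
filterB-++ p (x ∷ xs) ys with p x
... | true  = cong (x ∷_) (filterB-++ p xs ys)
... | false = filterB-++ p xs ys

filterB-cong : ∀ {A : Set} {p q : A → Bool} xs → (∀ {x} → x ∈ xs → p x ≡ q x) → filterB p xs ≡ filterB q xs
filterB-cong []       eq = refl
filterB-cong {q = q} (x ∷ xs) eq rewrite eq (here refl) with q x
... | true  = cong (x ∷_) (filterB-cong xs (eq ∘ there))
... | false = filterB-cong xs (eq ∘ there)

anyB-++ : ∀ {A : Set} (p : A → Bool) xs ys → anyB p (xs ++ ys) ≡ anyB p xs ∨ anyB p ys
anyB-++ p []       ys = refl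
anyB-++ p (x ∷ xs) ys = trans (cong (p x ∨_) (anyB-++ p xs ys)) (sym (∨-assoc (p x) _ _))

flag : Word → ℕ
flag β = if isNonempty β then 1 else 0

flags : ∀ {s} → Vec Word s → Vec ℕ s
flags = Vec.map flag

descents : ℕ → ℕ → ℕ → List Word → ℕ
descents lo n i t = length (filterB (λ a → anyB (isDescent i a) t) (interval lo n))

wt : (r lo n : ℕ) → List Word → Mon r
wt r lo n t = tabulate (λ i → descents lo n (toℕ i) t)

weight≡wt : ∀ r n t → weight r n t ≡ wt r 0 n t
weight≡wt r n t = cong (λ I → tabulate (λ i → length (filterB (λ a → anyB (isDescent (toℕ i) a) t) I)))
                       (sym (interval≡idWord n))

infixl 6 _⊕_ _⊖_

-- On exponent vectors this is multiplication of monomials, and `⊖` is the complementary factor that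
-- appears in `*ₛ`.
_⊕_ : ∀ {s} → Vec ℕ s → Vec ℕ s → Vec ℕ s
_⊕_ = zipWith _+_

_⊖_ : ∀ {s} → Vec ℕ s → Vec ℕ s → Vec ℕ s
_⊖_ = zipWith _∸_

module _ {r lo p q : ℕ} {αs : List Word} {βs : Vec Word (suc (suc r))} {γs : List Word} where
  private
    m : ℕ
    m = suc (lo + (p + q))
  open Node m αs βs γs

  module _ (gl : Good (suc r) lo p left) (gr : Good (suc r) (lo + p) q γs) where
    private
      module L = Good gl
      module R = Good gr
      left<m : Below m (concat left)
      left<m = left-bound {r} {lo} {p} {q} {αs} {βs} {γs} L.sorted
      γs<m : Below m (concat γs)
      γs<m = right-bound {r} {lo} {p} {q} {αs} {βs} {γs} R.sorted

    descents-low : ∀ i {a} → a ∈ interval lo p → anyB (isDescent i a) node ≡ anyB (isDescent i a) left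
    descents-low i {a} a∈ = begin
      D node                              ≡⟨ anyB-++ (isDescent i a) αs (x ∷ γs) ⟩
      D αs ∨ (isDescent i a x ∨ D γs)     ≡⟨ cong (λ z → D αs ∨ (isDescent i a x ∨ z)) (anyB-descent-∉ i γs a∉γs) ⟩
      D αs ∨ (isDescent i a x ∨ false)    ≡⟨ cong (D αs ∨_) (∨-identityʳ _) ⟩
      D αs ∨ isDescent i a x              ≡⟨ cong (D αs ∨_) (isDescent-glue i βs a<m sepβ) ⟩
      D αs ∨ D (toList βs)                ≡⟨ cong (D αs ∨_) (sym
                                                (anyB-nonempties (isDescent i a) (isDescent-∉ i [] λ ()) (toList βs))) ⟩
      D αs ∨ D (nonempties (toList βs))   ≡⟨ sym (anyB-++ (isDescent i a) αs _) ⟩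
      D left ∎
      where
      open ≡-Reasoning
      D : List Word → Bool
      D = anyB (isDescent i a)
      a≤ : a ≤ lo + p
      a≤ = proj₂ (∈-interval⁻ lo p a∈)
      a∉γs : a ∉ concat γs
      a∉γs a∈γs = <⇒≱ (proj₁ (letters⁻ γs R.sorted a∈γs)) a≤
      a<m : a < m
      a<m = s≤s (≤-trans a≤ (+-monoʳ-≤ lo (m≤m+n p q)))
      sepβ : Separated (toList βs)
      sepβ = separated-nonempties⁻ (toList βs) (proj₁ (proj₂ (separated-++⁻ αs L.sep)))

    descents-high : ∀ i {a} → a ∈ interval (lo + p) q → anyB (isDescent i a) node ≡ anyB (isDescent i a) γs
    descents-high i {a} a∈ = begin
      D node                            ≡⟨ anyB-++ (isDescent i a) αs (x ∷ γs) ⟩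
      D αs ∨ (isDescent i a x ∨ D γs)   ≡⟨ cong₂ (λ y z → y ∨ (z ∨ D γs))
                                             (anyB-descent-∉ i αs (a∉left ∘ αs⊆left)) (isDescent-∉ i x a∉x) ⟩
      D γs ∎
      where
      open ≡-Reasoning
      D : List Word → Bool
      D = anyB (isDescent i a)
      a∉left : a ∉ concat left
      a∉left a∈l = <⇒≱ (proj₁ (∈-interval⁻ (lo + p) q a∈)) (proj₂ (letters⁻ left L.sorted a∈l))
      a<m : a < m
      a<m = s≤s (subst (a ≤_) (+-assoc lo p q) (proj₂ (∈-interval⁻ (lo + p) q a∈)))
      a∉x : a ∉ x
      a∉x a∈x with ∈-glue⁻ m βs a∈x
      ... | inj₁ a≡m = <⇒≢ a<m a≡m
      ... | inj₂ a∈l = a∉left (βs⊆left a∈l)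

    descents-top : ∀ i → anyB (isDescent (toℕ i) m) node ≡ isNonempty (lookup βs i)
    descents-top i = begin
      D node                                     ≡⟨ anyB-++ (isDescent (toℕ i) m) αs (x ∷ γs) ⟩
      D αs ∨ (isDescent (toℕ i) m x ∨ D γs)      ≡⟨ cong₂ (λ y z → y ∨ (isDescent (toℕ i) m x ∨ z))
                                                     (anyB-descent-∉ (toℕ i) αs (below∌ (left<m ∘ αs⊆left)))
                                                     (anyB-descent-∉ (toℕ i) γs (below∌ γs<m)) ⟩
      isDescent (toℕ i) m x ∨ false              ≡⟨ ∨-identityʳ _ ⟩
      isDescent (toℕ i) m x                      ≡⟨ isDescent-glue-top m βs (left<m ∘ βs⊆left) i ⟩
      isNonempty (lookup βs i) ∎
      where
      open ≡-Reasoning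
      D : List Word → Bool
      D = anyB (isDescent (toℕ i) m)

    -- Every letter sees only its own piece: the lower interval has its descents in `left`, the
    -- upper one in `γs`, and `m` adds one to type i exactly when block i is nonempty.
    descents-node : ∀ i → descents lo (suc (p + q)) (toℕ i) node ≡
                    descents lo p (toℕ i) left + flag (lookup βs i) + descents (lo + p) q (toℕ i) γs
    descents-node i = begin
      length (filterB P (interval lo (suc (p + q))))
        ≡⟨ cong (length ∘ filterB P) (trans (interval-snoc lo (p + q)) (cong (_++ [ m ]) (interval-++ lo p q))) ⟩
      length (filterB P ((interval lo p ++ interval (lo + p) q) ++ [ m ]))
        ≡⟨ cong length (trans (filterB-++ P (interval lo p ++ interval (lo + p) q) [ m ])
                              (cong (_++ filterB P [ m ]) (filterB-++ P (interval lo p) (interval (lo + p) q)))) ⟩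
      length ((filterB P (interval lo p) ++ filterB P (interval (lo + p) q)) ++ filterB P [ m ])
        ≡⟨ trans (length-++ (filterB P (interval lo p) ++ _))
                 (cong (_+ length (filterB P [ m ])) (length-++ (filterB P (interval lo p)))) ⟩
      length (filterB P (interval lo p)) + length (filterB P (interval (lo + p) q)) + length (filterB P [ m ])
        ≡⟨ cong₂ _+_ (cong₂ _+_ (cong length (filterB-cong (interval lo p) (descents-low (toℕ i))))
                                (cong length (filterB-cong (interval (lo + p) q) (descents-high (toℕ i)))))
                     (trans length-top (cong (λ b → if b then 1 else 0) (descents-top i))) ⟩
      descents lo p (toℕ i) left + descents (lo + p) q (toℕ i) γs + flag (lookup βs i)
        ≡⟨ trans (+-assoc (descents lo p (toℕ i) left) _ _)
          (trans (cong (descents lo p (toℕ i) left +_) (+-comm (descents (lo + p) q (toℕ i) γs) _))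
                 (sym (+-assoc (descents lo p (toℕ i) left) _ _))) ⟩
      descents lo p (toℕ i) left + flag (lookup βs i) + descents (lo + p) q (toℕ i) γs ∎
      where
      open ≡-Reasoning
      P : ℕ → Bool
      P a = anyB (isDescent (toℕ i) a) node
      length-top : length (filterB P [ m ]) ≡ (if P m then 1 else 0)
      length-top with P m
      ... | true  = refl
      ... | false = refl

    wt-node : wt (suc r) lo (suc (p + q)) node ≡
              wt (suc r) lo p left ⊕ flags βs ⊕ wt (suc r) (lo + p) q γs
    wt-node = trans (Vec.tabulate-cong pointwise) (Vec.tabulate∘lookup _)
      where
      pointwise : ∀ i → descents lo (suc (p + q)) (toℕ i) node ≡
                  lookup (wt (suc r) lo p left ⊕ flags βs ⊕ wt (suc r) (lo + p) q γs) i
      pointwise i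
        rewrite Vec.lookup-zipWith _+_ i (wt (suc r) lo p left ⊕ flags βs) (wt (suc r) (lo + p) q γs)
              | Vec.lookup-zipWith _+_ i (wt (suc r) lo p left) (flags βs)
              | Vec.lookup∘tabulate (λ i → descents lo p (toℕ i) left) i
              | Vec.lookup∘tabulate (λ i → descents (lo + p) q (toℕ i) γs) i
              | Vec.lookup-map i flag βs = descents-node i

-- Squarefree exponent vectors and the inverse of the cut.

vsum : ∀ {s} → Vec ℕ s → ℕ
vsum v = sumℕ (toList v)

vsum-⊕ : ∀ {s} (u v : Vec ℕ s) → vsum (u ⊕ v) ≡ vsum u + vsum v
vsum-⊕ []      []      = refl
vsum-⊕ (a ∷ u) (b ∷ v) = trans (cong (a + b +_) (vsum-⊕ u v)) (+-interchange a b _ _)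

⊕⊖-cancel : ∀ {s} (u v : Vec ℕ s) → (u ⊕ v) ⊖ u ≡ v
⊕⊖-cancel []      []      = refl
⊕⊖-cancel (a ∷ u) (b ∷ v) = cong₂ _∷_ (m+n∸m≡n a b) (⊕⊖-cancel u v)

⊕-comm : ∀ {s} (u v : Vec ℕ s) → u ⊕ v ≡ v ⊕ u
⊕-comm []      []      = refl
⊕-comm (a ∷ u) (b ∷ v) = cong₂ _∷_ (+-comm a b) (⊕-comm u v)

-- Squarefree monomials: those of sum j are the monomials of e_j. The same vector encodes the set of
-- positions of the nonempty blocks.
IsMask : ∀ {s} → Vec ℕ s → Set
IsMask e = T (allB (λ n → n ≤ᵇ 1) (toList e))

flags-mask : ∀ {s} (βs : Vec Word s) → IsMask (flags βs)
flags-mask []             = tt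
flags-mask ([] ∷ βs)      = flags-mask βs
flags-mask ((_ ∷ _) ∷ βs) = flags-mask βs

vsum-flags : ∀ {s} (βs : Vec Word s) → vsum (flags βs) ≡ length (nonempties (toList βs))
vsum-flags []             = refl
vsum-flags ([] ∷ βs)      = vsum-flags βs
vsum-flags ((_ ∷ _) ∷ βs) = cong suc (vsum-flags βs)

-- Inverse of sending `βs` to its flags and its nonempty blocks, provided that the mask has as many
-- ones as there are words. If the words run out, the block defaults to the empty word.
fill : ∀ {s} → Vec ℕ s → List Word → Vec Word s
fill []          ws       = []
fill (zero  ∷ e) ws       = [] ∷ fill e ws
fill (suc _ ∷ e) []       = [] ∷ fill e []
fill (suc _ ∷ e) (w ∷ ws) = w ∷ fill e ws

fill-flags : ∀ {s} (βs : Vec Word s) → fill (flags βs) (nonempties (toList βs)) ≡ βs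
fill-flags []             = refl
fill-flags ([] ∷ βs)      = cong ([] ∷_) (fill-flags βs)
fill-flags ((_ ∷ _) ∷ βs) = cong (_ ∷_) (fill-flags βs)

flags-fill : ∀ {s} (e : Vec ℕ s) ws → IsMask e → vsum e ≡ length ws → All (_≢ []) ws →
             flags (fill e ws) ≡ e
flags-fill []         ws mask eq ne = refl
flags-fill (zero ∷ e) ws mask eq ne = cong (0 ∷_) (flags-fill e ws mask eq ne)
flags-fill (suc zero ∷ e) ([] ∷ ws)      mask eq (n ∷ ne) = ⊥-elim (n refl)
flags-fill (suc zero ∷ e) ((_ ∷ _) ∷ ws) mask eq (n ∷ ne) =
  cong (1 ∷_) (flags-fill e ws mask (suc-injective eq) ne)

nonempties-fill : ∀ {s} (e : Vec ℕ s) ws → IsMask e → vsum e ≡ length ws → All (_≢ []) ws →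
                  nonempties (toList (fill e ws)) ≡ ws
nonempties-fill []         [] mask eq ne = refl
nonempties-fill (zero ∷ e) ws mask eq ne = nonempties-fill e ws mask eq ne
nonempties-fill (suc zero ∷ e) ([] ∷ ws)      mask eq (n ∷ ne) = ⊥-elim (n refl)
nonempties-fill (suc zero ∷ e) ((_ ∷ _) ∷ ws) mask eq (n ∷ ne) =
  cong (_ ∷_) (nonempties-fill e ws mask (suc-injective eq) ne)

glue-injective : ∀ {s m} (βs βs′ : Vec Word (suc s)) → m ∉ letters βs → m ∉ letters βs′ →
                 glue m βs ≡ glue m βs′ → βs ≡ βs′
glue-injective βs βs′ m∉ m∉′ eq = trans (sym (Vec.cast-is-id refl βs)) (Vec.toList-injective refl βs βs′
  (trans (sym (splitAt-glue βs m∉)) (trans (cong (splitAt _) eq) (splitAt-glue βs′ m∉′))))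

-- The letter `m` marks the cut: the distinguished component is the first one that contains it, and
-- both decompositions must agree on that.
component-injective : ∀ {m : ℕ} (αs αs′ : List Word) {x x′ γs γs′} → m ∈ x → m ∈ x′ →
                      m ∉ concat αs → m ∉ concat αs′ → αs ++ x ∷ γs ≡ αs′ ++ x′ ∷ γs′ →
                      αs ≡ αs′ × x ≡ x′ × γs ≡ γs′
component-injective []       []         m∈ m∈′ m∉ m∉′ refl = refl , refl , refl
component-injective []       (α′ ∷ αs′) m∈ m∈′ m∉ m∉′ refl = ⊥-elim (m∉′ (∈-++⁺ˡ m∈))
component-injective (α ∷ αs) []         m∈ m∈′ m∉ m∉′ refl = ⊥-elim (m∉ (∈-++⁺ˡ m∈′))
component-injective (α ∷ αs) (α′ ∷ αs′) m∈ m∈′ m∉ m∉′ eq with ∷-injective eq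
... | refl , eq′ with component-injective αs αs′ m∈ m∈′ (m∉ ∘ ∈-++⁺ʳ α) (m∉′ ∘ ∈-++⁺ʳ α) eq′
... | refl , refl , refl = refl , refl , refl

-- The number `a` says where `αs` ends inside `t₁` and the mask `e` says which blocks are nonempty:
-- precisely the data that `left` forgets.
join : ∀ {s} → ℕ → ℕ → (Vec ℕ (suc s) × List Word) × List Word → List Word
join m a ((e , t₁) , t₂) = take a t₁ ++ glue m (fill e (drop a t₁)) ∷ t₂

node-good : ∀ {r lo p q n} αs (βs : Vec Word (suc (suc r))) γs → p + q ≡ n →
            Good (suc r) lo p (αs ++ nonempties (toList βs)) → Good (suc r) (lo + p) q γs →
            Good (suc r) lo (suc n) (αs ++ glue (suc (lo + n)) βs ∷ γs)
node-good {r} {lo} {p} {q} αs βs γs refl = compose {r} {lo} {p} {q} {αs} {βs} {γs}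

node-wt : ∀ {r lo p q n} αs (βs : Vec Word (suc (suc r))) γs → p + q ≡ n →
          Good (suc r) lo p (αs ++ nonempties (toList βs)) → Good (suc r) (lo + p) q γs →
          wt (suc r) lo (suc n) (αs ++ glue (suc (lo + n)) βs ∷ γs) ≡
          wt (suc r) lo p (αs ++ nonempties (toList βs)) ⊕ flags βs ⊕ wt (suc r) (lo + p) q γs
node-wt {r} {lo} {p} {q} αs βs γs refl = wt-node {r} {lo} {p} {q} {αs} {βs} {γs}

-- The conditions under which `join` undoes the cut: `len` makes the part of `t₁` after its first
-- `a` components fit the mask, and `size` makes the letter inserted by `join` larger than all
-- others.
record Pieces (r lo n a p q : ℕ) (e : Mon (suc r)) (t₁ t₂ : List Word) : Set where
  field
    size  : p + q ≡ n
    goodˡ : Good (suc r) lo p t₁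
    goodʳ : Good (suc r) (lo + p) q t₂
    mask  : IsMask e
    len   : length t₁ ≡ a + vsum e

  length-left : length (take a t₁) ≡ a
  length-left = trans (length-take a t₁)
    (m≤n⇒m⊓n≡m (subst (a ≤_) (sym len) (m≤m+n a (vsum e))))

  length-blocks : vsum e ≡ length (drop a t₁)
  length-blocks = sym (trans (length-drop a t₁) (trans (cong (_∸ a) len) (m+n∸m≡n a (vsum e))))

  blocks-nonempty : All (_≢ []) (drop a t₁)
  blocks-nonempty = All.drop⁺ a (Good.nonempty goodˡ)

  blocks : Vec Word (suc (suc r))
  blocks = fill e (drop a t₁)

  nonempties-blocks : nonempties (toList blocks) ≡ drop a t₁
  nonempties-blocks = nonempties-fill e (drop a t₁) mask length-blocks blocks-nonempty

  left≡ : take a t₁ ++ nonempties (toList blocks) ≡ t₁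
  left≡ = trans (cong (take a t₁ ++_) nonempties-blocks) (take++drop≡id a t₁)

  flags-blocks : flags blocks ≡ e
  flags-blocks = flags-fill e (drop a t₁) mask length-blocks blocks-nonempty

  join-good : Good (suc r) lo (suc n) (join (suc (lo + n)) a ((e , t₁) , t₂))
  join-good = node-good (take a t₁) blocks t₂ size (subst (Good (suc r) lo p) (sym left≡) goodˡ) goodʳ

  join-wt : wt (suc r) lo (suc n) (join (suc (lo + n)) a ((e , t₁) , t₂)) ≡
            wt (suc r) lo p t₁ ⊕ e ⊕ wt (suc r) (lo + p) q t₂
  join-wt =
    trans (node-wt (take a t₁) blocks t₂ size (subst (Good (suc r) lo p) (sym left≡) goodˡ) goodʳ)
          (cong₂ (λ t f → wt (suc r) lo p t ⊕ f ⊕ wt (suc r) (lo + p) q t₂) left≡ flags-blocks)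

  top∉left : suc (lo + n) ∉ concat t₁
  top∉left top∈ =
    <⇒≱ (s≤s (+-monoʳ-≤ lo (subst (p ≤_) size (m≤m+n p q)))) (proj₂ (letters⁻ t₁ (Good.sorted goodˡ) top∈))

  concat-parts : concat t₁ ≡ concat (take a t₁) ++ letters blocks
  concat-parts = trans (cong concat (sym left≡))
    (trans (sym (concat-++ (take a t₁) _)) (cong (concat (take a t₁) ++_) (concat-nonempties (toList blocks))))

  top∉αs : suc (lo + n) ∉ concat (take a t₁)
  top∉αs top∈ = top∉left (subst (_ ∈_) (sym concat-parts) (∈-++⁺ˡ top∈))

  top∉blocks : suc (lo + n) ∉ letters blocks
  top∉blocks top∈ = top∉left (subst (_ ∈_) (sym concat-parts) (∈-++⁺ʳ (concat (take a t₁)) top∈))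

-- The largest letter locates the component, its copies locate the blocks, and the blocks give back
-- `e` and the end of `t₁`. This is the source of all freeness from repetition in `gen`.
join-injective : ∀ {r lo n a a′ p p′ q q′ e e′ t₁ t₁′ t₂ t₂′} →
                 Pieces r lo n a p q e t₁ t₂ → Pieces r lo n a′ p′ q′ e′ t₁′ t₂′ →
                 join (suc (lo + n)) a ((e , t₁) , t₂) ≡ join (suc (lo + n)) a′ ((e′ , t₁′) , t₂′) →
                 a ≡ a′ × e ≡ e′ × t₁ ≡ t₁′ × t₂ ≡ t₂′
join-injective {a = a} {a′} P P′ eq =
  let αs≡ , x≡ , t₂≡ = component-injective _ _ (top∈glue _ X.blocks) (top∈glue _ Y.blocks) X.top∉αs Y.top∉αs eq
      blocks≡ = glue-injective X.blocks Y.blocks X.top∉blocks Y.top∉blocks x≡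
  in trans (sym X.length-left) (trans (cong length αs≡) Y.length-left) ,
     trans (sym X.flags-blocks) (trans (cong flags blocks≡) Y.flags-blocks) ,
     trans (sym X.left≡) (trans (cong₂ (λ u v → u ++ nonempties (toList v)) αs≡ blocks≡) Y.left≡) ,
     t₂≡
  where
  module X = Pieces P
  module Y = Pieces P′

-- Enumeration by recursive cuts

module _ {A B : Set} {f : A → List B} where

  ∈-concatMap-intro : ∀ {x y xs} → x ∈ xs → y ∈ f x → y ∈ concatMap f xs
  ∈-concatMap-intro x∈ y∈ = ∈-concatMap⁺ f (lose x∈ y∈)

  ∈-concatMap-elim : ∀ {y} xs → y ∈ concatMap f xs → ∃ λ x → x ∈ xs × y ∈ f x
  ∈-concatMap-elim xs y∈ = find (∈-concatMap⁻ f {xs = xs} y∈)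

  concatMap-unique : ∀ {xs} → Unique xs → (∀ {x} → x ∈ xs → Unique (f x)) →
                     (∀ {x x′ y} → x ∈ xs → x′ ∈ xs → y ∈ f x → y ∈ f x′ → x ≡ x′) →
                     Unique (concatMap f xs)
  concatMap-unique []          uf inj = []
  concatMap-unique {x ∷ xs} (x∉ ∷ ux) uf inj =
    Unique.++⁺ (uf (here refl)) (concatMap-unique ux (uf ∘ there) (λ p q → inj (there p) (there q)))
      λ { (y∈x , y∈xs) → let x′ , x′∈ , y∈x′ = ∈-concatMap-elim xs y∈xs in
            All.lookup x∉ x′∈ (inj (here refl) (there x′∈) y∈x y∈x′) }

map-unique : ∀ {A B : Set} {f : A → B} {xs} → Unique xs →
             (∀ {x x′} → x ∈ xs → x′ ∈ xs → f x ≡ f x′ → x ≡ x′) → Unique (map f xs)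
map-unique []        inj = []
map-unique {f = f} {x ∷ xs} (x∉ ∷ ux) inj =
  All.tabulate (λ y∈ eq → let x′ , x′∈ , y≡ = ∈-map⁻ f y∈ in
                 All.lookup x∉ x′∈ (inj (here refl) (there x′∈) (trans eq y≡)))
  ∷ map-unique ux (λ p q → inj (there p) (there q))

take-length-++ : ∀ {A : Set} (us vs : List A) → take (length us) (us ++ vs) ≡ us
take-length-++ []       vs = refl
take-length-++ (u ∷ us) vs = cong (u ∷_) (take-length-++ us vs)

drop-length-++ : ∀ {A : Set} (us vs : List A) → drop (length us) (us ++ vs) ≡ vs
drop-length-++ []       vs = refl
drop-length-++ (u ∷ us) vs = drop-length-++ us vs

below-⊕ : ∀ {s} (u v : Vec ℕ s) → u ∈ below (u ⊕ v)
below-⊕ []      []      = here refl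
below-⊕ (a ∷ u) (b ∷ v) =
  ∈-concatMap-intro (∈-upTo⁺ (s≤s (m≤m+n a b))) (∈-map⁺ (a ∷_) (below-⊕ u v))

below-⊕⊖ : ∀ {s} (m : Vec ℕ s) {d} → d ∈ below m → d ⊕ (m ⊖ d) ≡ m
below-⊕⊖ []      (here refl) = refl
below-⊕⊖ (a ∷ m) d∈ with ∈-concatMap-elim (upTo (suc a)) d∈
... | i , i∈ , d∈′ with ∈-map⁻ (i ∷_) d∈′
... | d , d∈m , refl = cong₂ _∷_ (m+[n∸m]≡n (s≤s⁻¹ (∈-upTo⁻ i∈))) (below-⊕⊖ m d∈m)

below-unique : ∀ {s} (m : Vec ℕ s) → Unique (below m)
below-unique []      = [] ∷ []
below-unique (a ∷ m) = concatMap-unique (Unique.upTo⁺ (suc a))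
  (λ _ → map-unique (below-unique m) (λ { _ _ refl → refl }))
  (λ {i} {i′} _ _ y∈ y∈′ → same (∈-map⁻ (i ∷_) y∈) (∈-map⁻ (i′ ∷_) y∈′))
  where
  same : ∀ {i i′ y} → (∃ λ d → d ∈ below m × y ≡ i ∷ d) → (∃ λ d → d ∈ below m × y ≡ i′ ∷ d) → i ≡ i′
  same (_ , _ , refl) (_ , _ , refl) = refl

isZero : ∀ {s} → Vec ℕ s → Bool
isZero m = allB (λ e → e ≡ᵇ 0) (toList m)

-- Spelled like the test inside `elemSym`, so that one case distinction on it reduces both the
-- enumeration and the coefficient of e_j; `isZero` does the same for `oneₛ`.
isElem : ∀ {s} → ℕ → Vec ℕ s → Bool
isElem j m = allB (λ e → e ≤ᵇ 1) (toList m) ∧ (sumℕ (toList m) ≡ᵇ j)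

isElem⁻ : ∀ {s} j (e : Vec ℕ s) → T (isElem j e) → IsMask e × vsum e ≡ j
isElem⁻ j e el = let mask , eq = Equivalence.to T-∧ el in mask , ≡ᵇ⇒≡ _ j eq

isElem⁺ : ∀ {s} (e : Vec ℕ s) → IsMask e → T (isElem (vsum e) e)
isElem⁺ e mask = Equivalence.from T-∧ (mask , ≡⇒≡ᵇ (vsum e) (vsum e) refl)

isZero⁻ : ∀ {s} (m : Vec ℕ s) → T (isZero m) → vsum m ≡ 0 × tabulate (λ _ → 0) ≡ m
isZero⁻ []         z = refl , refl
isZero⁻ (zero ∷ m) z = let v , eq = isZero⁻ m z in v , cong (0 ∷_) eq

isZero⁺ : ∀ s → isZero {s} (tabulate (λ _ → 0)) ≡ true × vsum {s} (tabulate (λ _ → 0)) ≡ 0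
isZero⁺ zero    = refl , refl
isZero⁺ (suc s) = isZero⁺ s

module _ {r : ℕ} where

  mutual
    -- The first argument is fuel, any bound on k + |m|; lo shifts the alphabet to lo+1, lo+2, ….
    gen : ℕ → ℕ → ℕ → Mon (suc r) → List (List Word)
    gen N       lo zero    m = if isZero m then [] ∷ [] else []
    gen zero    lo (suc k) m = []
    gen (suc N) lo (suc k) m =
      concatMap (λ a → concatMap (joins N lo k m a) (below m)) (upTo (suc k))

    -- A tuple with k + 1 components and weight m has k + 1 + |m| letters, which explains the
    -- inserted largest letter. The weight m is shared out as `d` for the left tuple with its mask
    -- and `m ⊖ d` for the right.
    joins : ℕ → ℕ → ℕ → Mon (suc r) → ℕ → Mon (suc r) → List (List Word)
    joins N lo k m a d = map (join (suc (lo + (k + vsum m))) a) (pairs N lo a d (k ∸ a) (m ⊖ d))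

    -- A left tuple of weight w whose mask has j ones has a + j components, hence a + j + |w| = a +
    -- |d| letters. The right alphabet starts above these.
    pairs : ℕ → ℕ → ℕ → Mon (suc r) → ℕ → Mon (suc r) → List ((Mon (suc r) × List Word) × List Word)
    pairs N lo a d b d′ = cartesianProduct (lefts N lo a d) (gen N (lo + (a + vsum d)) b d′)

    -- The ranges are those of `Fof` and of the product with e_j. The bound on j lets it run from 0
    -- to r + 2, the number of blocks.
    lefts : ℕ → ℕ → ℕ → Mon (suc r) → List (Mon (suc r) × List Word)
    lefts N lo a d = concatMap (λ j → concatMap (leftsFrom N lo a d j) (below d)) (upTo (suc (suc (suc r))))

    leftsFrom : ℕ → ℕ → ℕ → Mon (suc r) → ℕ → Mon (suc r) → List (Mon (suc r) × List Word)
    leftsFrom N lo a d j d′ =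
      if isElem j (d ⊖ d′) then map (d ⊖ d′ ,_) (gen N lo (a + j) d′) else []

  record Sound (lo k : ℕ) (m : Mon (suc r)) (t : List Word) : Set where
    constructor sound
    field
      good : Good (suc r) lo (k + vsum m) t
      len  : length t ≡ k
      wt≡  : wt (suc r) lo (k + vsum m) t ≡ m

  ∈-leftsFrom⁻ : ∀ N lo a d j d′ {et} → et ∈ leftsFrom N lo a d j d′ →
                 T (isElem j (d ⊖ d′)) × proj₁ et ≡ d ⊖ d′ × proj₂ et ∈ gen N lo (a + j) d′
  ∈-leftsFrom⁻ N lo a d j d′ et∈ with isElem j (d ⊖ d′)
  ... | true with ∈-map⁻ (d ⊖ d′ ,_) et∈
  ... | t , t∈ , refl = tt , refl , t∈

  ∈-leftsFrom⁺ : ∀ N lo a d j d′ {t} → T (isElem j (d ⊖ d′)) → t ∈ gen N lo (a + j) d′ →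
                 (d ⊖ d′ , t) ∈ leftsFrom N lo a d j d′
  ∈-leftsFrom⁺ N lo a d j d′ el t∈ with isElem j (d ⊖ d′)
  ... | true = ∈-map⁺ (d ⊖ d′ ,_) t∈

  good-[] : ∀ {lo} → Good (suc r) lo 0 []
  good-[] = record { nonempty = [] ; pat = [] ; sep = tt ; cnt = λ () ; sorted = refl }

  record LeftSound (lo a : ℕ) (d : Mon (suc r)) (e : Mon (suc r)) (t : List Word) : Set where
    field
      good : Good (suc r) lo (a + vsum d) t
      mask : IsMask e
      len  : length t ≡ a + vsum e
      wt≡  : wt (suc r) lo (a + vsum d) t ⊕ e ≡ d

  -- The exchange that balances the recursion: the components coming from the blocks on the left
  -- count as units of weight in `d′ ⊕ e`.
  left-size : ∀ a (d′ e : Mon (suc r)) → a + vsum e + vsum d′ ≡ a + vsum (d′ ⊕ e)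
  left-size a d′ e = trans (+-assoc a _ _) (cong (a +_) (trans (+-comm (vsum e) _) (sym (vsum-⊕ d′ e))))

  total-size : ∀ {a k} (d m : Mon (suc r)) → a ≤ k → d ⊕ (m ⊖ d) ≡ m →
               (a + vsum d) + (k ∸ a + vsum (m ⊖ d)) ≡ k + vsum m
  total-size {a} {k} d m a≤k eq = trans (+-interchange a (vsum d) (k ∸ a) _)
    (cong₂ _+_ (m+[n∸m]≡n a≤k) (trans (sym (vsum-⊕ d (m ⊖ d))) (cong vsum eq)))

  mutual
    gen-sound : ∀ N lo k m {t} → t ∈ gen N lo k m → Sound lo k m t
    gen-sound N lo zero m t∈ with isZero m in eq
    gen-sound N lo zero m (here refl) | true with isZero⁻ m (Equivalence.from T-≡ eq)
    ... | v , refl = sound (subst (λ n → Good (suc r) lo n []) (sym v) good-[]) refl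
                       (cong (λ n → wt (suc r) lo n []) v)
    gen-sound (suc N) lo (suc k) m t∈
      with a , a∈ , t∈a ← ∈-concatMap-elim (upTo (suc k)) t∈
      with d , d∈ , t∈d ← ∈-concatMap-elim (below m) t∈a
      with ((e , t₁) , t₂) , pair∈ , refl ← ∈-map⁻ (join (suc (lo + (k + vsum m))) a) t∈d =
      let P = pieces-sound N lo k m a∈ d∈ pair∈
          open Pieces (proj₁ P)
          L , R = proj₂ P
      in sound join-good
           (trans (length-++ (take a t₁)) (trans (cong₂ (λ u v → u + suc v) length-left (Sound.len R))
             (trans (+-suc a _) (cong suc (m+[n∸m]≡n (s≤s⁻¹ (∈-upTo⁻ a∈)))))))
           (trans join-wt (trans (cong₂ _⊕_ (LeftSound.wt≡ L) (Sound.wt≡ R)) (below-⊕⊖ m d∈)))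

    -- Kept apart from `gen-sound` because uniqueness needs the same `Pieces`, to feed
    -- `join-injective`.
    pieces-sound : ∀ N lo k m {a d e t₁ t₂} → a ∈ upTo (suc k) → d ∈ below m →
                   ((e , t₁) , t₂) ∈ pairs N lo a d (k ∸ a) (m ⊖ d) →
                   Pieces r lo (k + vsum m) a (a + vsum d) (k ∸ a + vsum (m ⊖ d)) e t₁ t₂ ×
                   LeftSound lo a d e t₁ × Sound (lo + (a + vsum d)) (k ∸ a) (m ⊖ d) t₂
    pieces-sound N lo k m {a} {d} {e} {t₁} {t₂} a∈ d∈ pair∈ =
      record { size  = total-size d m (s≤s⁻¹ (∈-upTo⁻ a∈)) (below-⊕⊖ m d∈)
             ; goodˡ = LeftSound.good L ; goodʳ = Sound.good R
             ; mask  = LeftSound.mask L ; len = LeftSound.len L } , L , R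
      where
      both : (e , t₁) ∈ lefts N lo a d × t₂ ∈ gen N (lo + (a + vsum d)) (k ∸ a) (m ⊖ d)
      both = ∈-cartesianProduct⁻ (lefts N lo a d) _ pair∈
      L : LeftSound lo a d e t₁
      L = lefts-sound N lo a d (proj₁ both)
      R : Sound (lo + (a + vsum d)) (k ∸ a) (m ⊖ d) t₂
      R = gen-sound N _ (k ∸ a) (m ⊖ d) (proj₂ both)

    lefts-sound : ∀ N lo a d {e t} → (e , t) ∈ lefts N lo a d → LeftSound lo a d e t
    lefts-sound N lo a d {t = t} et∈
      with j , j∈ , et∈j ← ∈-concatMap-elim (upTo (suc (suc (suc r)))) et∈
      with d′ , d′∈ , et∈d ← ∈-concatMap-elim (below d) et∈j
      with el , refl , t∈ ← ∈-leftsFrom⁻ N lo a d j d′ et∈d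
      with mask , refl ← isElem⁻ j (d ⊖ d′) el
      with sound good len wt≡ ← gen-sound N lo (a + j) d′ t∈ = record
        { good = subst (λ n → Good (suc r) lo n t) size good
        ; mask = mask
        ; len  = len
        ; wt≡  = trans (cong (_⊕ (d ⊖ d′)) (trans (cong (λ n → wt (suc r) lo n t) (sym size)) wt≡)) d≡ }
      where
      d≡ : d′ ⊕ (d ⊖ d′) ≡ d
      d≡ = below-⊕⊖ d d′∈
      size : a + vsum (d ⊖ d′) + vsum d′ ≡ a + vsum d
      size = trans (left-size a d′ (d ⊖ d′)) (cong (λ v → a + vsum v) d≡)

  good-size : ∀ {lo n n′ t} → Good (suc r) lo n t → Good (suc r) lo n′ t → n ≡ n′
  good-size {lo} {n} {n′} g g′ = trans (sym (length-interval lo n))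
    (trans (cong length (trans (sym (Good.sorted g)) (Good.sorted g′))) (length-interval lo n′))

  mutual
    gen-unique : ∀ N lo k m → Unique (gen N lo k m)
    gen-unique N lo zero m with isZero m
    ... | true  = [] ∷ []
    ... | false = []
    gen-unique zero    lo (suc k) m = []
    gen-unique (suc N) lo (suc k) m =
      concatMap-unique (Unique.upTo⁺ (suc k))
        (λ {a} a∈ → concatMap-unique (below-unique m)
          (λ {d} d∈ → map-unique
            (Unique.cartesianProduct⁺ (lefts-unique N lo a d) (gen-unique N _ (k ∸ a) (m ⊖ d)))
            λ { {(e , t₁) , t₂} {(e′ , t₁′) , t₂′} p∈ p∈′ eq →
                case-≡ (join-injective (proj₁ (pieces-sound N lo k m a∈ d∈ p∈))
                                       (proj₁ (pieces-sound N lo k m a∈ d∈ p∈′)) eq) })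
          (λ {d} {d′} d∈ d∈′ t∈ t∈′ → same-d a∈ d∈ d∈′ (∈-map⁻ (join _ a) t∈) (∈-map⁻ (join _ a) t∈′)))
        λ {a} {a′} a∈ a∈′ t∈ t∈′ →
          let d , d∈ , t∈d = ∈-concatMap-elim (below m) t∈
              d′ , d∈′ , t∈d′ = ∈-concatMap-elim (below m) t∈′
          in same-a a∈ a∈′ d∈ d∈′ (∈-map⁻ (join _ a) t∈d) (∈-map⁻ (join _ a′) t∈d′)
      where
      case-≡ : ∀ {a : ℕ} {e e′ : Mon (suc r)} {t₁ t₁′ t₂ t₂′ : List Word} →
               a ≡ a × e ≡ e′ × t₁ ≡ t₁′ × t₂ ≡ t₂′ → ((e , t₁) , t₂) ≡ ((e′ , t₁′) , t₂′)
      case-≡ (_ , refl , refl , refl) = refl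
      Image : ℕ → Mon (suc r) → List Word → Set
      Image a d t = ∃ λ et → et ∈ pairs N lo a d (k ∸ a) (m ⊖ d) × t ≡ join (suc (lo + (k + vsum m))) a et
      same-a : ∀ {a a′ d d′ t} → a ∈ upTo (suc k) → a′ ∈ upTo (suc k) → d ∈ below m → d′ ∈ below m →
               Image a d t → Image a′ d′ t → a ≡ a′
      same-a a∈ a∈′ d∈ d∈′ (_ , p∈ , refl) (_ , p∈′ , eq) =
        proj₁ (join-injective (proj₁ (pieces-sound N lo k m a∈ d∈ p∈))
                              (proj₁ (pieces-sound N lo k m a∈′ d∈′ p∈′)) eq)
      same-d : ∀ {a d d′ t} → a ∈ upTo (suc k) → d ∈ below m → d′ ∈ below m →
               Image a d t → Image a d′ t → d ≡ d′
      same-d a∈ d∈ d∈′ (((e , t₁) , _) , p∈ , refl) (_ , p∈′ , eq)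
        with pieces-sound N lo k m a∈ d∈ p∈ | pieces-sound N lo k m a∈ d∈′ p∈′
      ... | P , L , _ | P′ , L′ , _ with join-injective P P′ eq
      -- Both `d` and `d′` are the weight of the same left tuple times the same mask, but with
      -- descents counted over a + |d| and a + |d′| letters. `good-size` identifies these two
      -- numbers.
      ... | _ , refl , refl , refl = trans (sym (LeftSound.wt≡ L))
        (trans (cong (λ n → wt (suc r) lo n t₁ ⊕ e) (good-size (LeftSound.good L) (LeftSound.good L′)))
               (LeftSound.wt≡ L′))

    -- The mask alone determines both indices: j is its sum, and the weight of the tuple is `d`
    -- divided by it.
    lefts-unique : ∀ N lo a d → Unique (lefts N lo a d)
    lefts-unique N lo a d = concatMap-unique (Unique.upTo⁺ (suc (suc (suc r))))
      (λ {j} _ → concatMap-unique (below-unique d) (λ {d′} _ → leftsFrom-unique j d′)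
        (λ {d₁} {d₂} d₁∈ d₂∈ et∈ et∈′ → same-d d₁∈ d₂∈
          (proj₁ (proj₂ (∈-leftsFrom⁻ N lo a d j d₁ et∈))) (proj₁ (proj₂ (∈-leftsFrom⁻ N lo a d j d₂ et∈′)))))
      λ {j} {j′} _ _ et∈ et∈′ → trans (sym (size-j j et∈)) (size-j j′ et∈′)
      where
      leftsFrom-unique : ∀ j d′ → Unique (leftsFrom N lo a d j d′)
      leftsFrom-unique j d′ with isElem j (d ⊖ d′)
      ... | true  = map-unique (gen-unique N lo (a + j) d′) (λ { _ _ refl → refl })
      ... | false = []
      same-d : ∀ {d₁ d₂ e} → d₁ ∈ below d → d₂ ∈ below d → e ≡ d ⊖ d₁ → e ≡ d ⊖ d₂ → d₁ ≡ d₂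
      same-d {d₁} {d₂} d₁∈ d₂∈ eq₁ eq₂ =
        trans (sym (cancel d₁∈)) (trans (cong (d ⊖_) (trans (sym eq₁) eq₂)) (cancel d₂∈))
        where
        cancel : ∀ {d′} → d′ ∈ below d → d ⊖ (d ⊖ d′) ≡ d′
        cancel {d′} d′∈ = trans (cong (_⊖ (d ⊖ d′)) (trans (sym (below-⊕⊖ d d′∈)) (⊕-comm d′ (d ⊖ d′))))
                                (⊕⊖-cancel (d ⊖ d′) d′)
      size-j : ∀ j {et} → et ∈ concatMap (leftsFrom N lo a d j) (below d) → vsum (proj₁ et) ≡ j
      size-j j et∈ with d′ , d′∈ , et∈d ← ∈-concatMap-elim (below d) et∈
        with el , eq , _ ← ∈-leftsFrom⁻ N lo a d j d′ et∈d =
        trans (cong vsum eq) (proj₂ (isElem⁻ j (d ⊖ d′) el))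

  good-0 : ∀ {lo} t → Good (suc r) lo 0 t → t ≡ []
  good-0 []            g = refl
  good-0 ([] ∷ t)      g = ⊥-elim (All.head (Good.nonempty g) refl)
  good-0 {lo} (α@(b ∷ _) ∷ t) g =
    let lo<b , b≤ = letters⁻ {b} (α ∷ t) (Good.sorted g) (here refl) in
    ⊥-elim (<⇒≱ lo<b (subst (b ≤_) (+-identityʳ lo) b≤))

  -- The numerical half is the identity letters = components + descents. It is proved together with
  -- membership because `gen` computes the sizes of its parts from k and m, never from n.
  Complete : ℕ → ℕ → ℕ → List Word → Set
  Complete N lo n t = n ≡ length t + vsum (wt (suc r) lo n t) ×
                      t ∈ gen N lo (length t) (wt (suc r) lo n t)

  mask-length : ∀ {s} (e : Vec ℕ s) → IsMask e → vsum e ≤ s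
  mask-length []             mask = z≤n
  mask-length (zero ∷ e)     mask = m≤n⇒m≤1+n (mask-length e mask)
  mask-length (suc zero ∷ e) mask = s≤s (mask-length e mask)

  ∈-lefts⁺ : ∀ {N lo a d′ t} (e : Mon (suc r)) → IsMask e → t ∈ gen N lo (a + vsum e) d′ →
             (e , t) ∈ lefts N lo a (d′ ⊕ e)
  ∈-lefts⁺ {N} {lo} {a} {d′} {t} e mask t∈ =
    ∈-concatMap-intro {f = λ j → concatMap (leftsFrom N lo a (d′ ⊕ e) j) (below (d′ ⊕ e))}
      (∈-upTo⁺ (s≤s (mask-length e mask)))
      (∈-concatMap-intro {f = leftsFrom N lo a (d′ ⊕ e) (vsum e)} (below-⊕ d′ e)
        (subst (λ e′ → (e′ , t) ∈ leftsFrom N lo a (d′ ⊕ e) (vsum e) d′) e≡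
          (∈-leftsFrom⁺ N lo a (d′ ⊕ e) (vsum e) d′ (subst (T ∘ isElem (vsum e)) (sym e≡) (isElem⁺ e mask)) t∈)))
    where
    e≡ : (d′ ⊕ e) ⊖ d′ ≡ e
    e≡ = ⊕⊖-cancel d′ e

  -- Stated with free p, q and n, so that the size equations can be matched away and a single
  -- transport remains, along the size identity for the joined tuple.
  join∈gen : ∀ {N lo a b p q n d′ d₂ t₁ t₂} (e : Mon (suc r)) → IsMask e → p + q ≡ n →
             p ≡ a + vsum (d′ ⊕ e) → q ≡ b + vsum d₂ →
             t₁ ∈ gen N lo (a + vsum e) d′ → t₂ ∈ gen N (lo + p) b d₂ →
             n ≡ a + b + vsum (d′ ⊕ e ⊕ d₂) ×
             join (suc (lo + n)) a ((e , t₁) , t₂) ∈ gen (suc N) lo (suc (a + b)) (d′ ⊕ e ⊕ d₂)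
  join∈gen {N} {lo} {a} {b} {d′ = d′} {d₂} {t₁} {t₂} e mask refl refl refl t₁∈ t₂∈ =
    n≡ , subst (λ n → join (suc (lo + n)) a ((e , t₁) , t₂) ∈ gen (suc N) lo (suc (a + b)) (d ⊕ d₂)) (sym n≡)
      (∈-concatMap-intro (∈-upTo⁺ (s≤s (m≤m+n a b)))
        (∈-concatMap-intro {xs = below (d ⊕ d₂)} (below-⊕ d d₂)
          (∈-map⁺ (join (suc (lo + (a + b + vsum (d ⊕ d₂)))) a)
            (∈-cartesianProduct⁺ (∈-lefts⁺ {N} {lo} {a} {d′} e mask t₁∈)
              (subst₂ (λ b d₂ → t₂ ∈ gen N (lo + (a + vsum d)) b d₂)
                (sym (m+n∸m≡n a b)) (sym (⊕⊖-cancel d d₂)) t₂∈)))))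
    where
    d : Mon (suc r)
    d = d′ ⊕ e
    n≡ : a + vsum d + (b + vsum d₂) ≡ a + b + vsum (d ⊕ d₂)
    n≡ = trans (+-interchange a (vsum d) b (vsum d₂)) (cong (a + b +_) (sym (vsum-⊕ d d₂)))

  -- The recursion is on fuel because the two sides of the cut are not structurally smaller;
  -- together they have one letter less than `t`, so each fits into the remaining fuel.
  gen-complete : ∀ N lo n t → n ≤ N → Good (suc r) lo n t → Complete N lo n t
  gen-complete N lo zero t n≤N g with refl ← good-0 t g =
    sym (proj₂ (isZero⁺ (suc (suc r)))) ,
    subst (λ b → [] ∈ (if b then [] ∷ [] else [])) (sym (proj₁ (isZero⁺ (suc (suc r))))) (here refl)
  gen-complete (suc N) lo (suc n) t (s≤s n≤N) g with decompose g
  ... | record { p = p ; q = q ; αs = αs ; βs = βs ; γs = γs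
               ; size = size ; shape = refl ; goodˡ = goodˡ ; goodʳ = goodʳ }
    with gen-complete N lo p _ (≤-trans (subst (p ≤_) size (m≤m+n p q)) n≤N) goodˡ
       | gen-complete N (lo + p) q γs (≤-trans (subst (q ≤_) size (m≤n+m q p)) n≤N) goodʳ
  ... | p≡ , left∈ | q≡ , right∈ = finish
    where
    open Node (suc (lo + n)) αs βs γs using (left; node)
    B : List Word
    B = toList βs
    a : ℕ
    a = length αs
    e d′ d₂ : Mon (suc r)
    e = flags βs
    d′ = wt (suc r) lo p left
    d₂ = wt (suc r) (lo + p) q γs
    length-left : length left ≡ a + vsum e
    length-left = trans (length-++ αs) (cong (a +_) (sym (vsum-flags βs)))
    joined : n ≡ a + length γs + vsum (d′ ⊕ e ⊕ d₂) ×
        join (suc (lo + n)) a ((e , left) , γs) ∈ gen (suc N) lo (suc (a + length γs)) (d′ ⊕ e ⊕ d₂)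
    joined = join∈gen {N} {lo} {a} {length γs} {p} {q} {n} {d′} {d₂} e (flags-mask βs) size
          (trans p≡ (trans (cong (_+ vsum d′) length-left) (left-size a d′ e))) q≡
          (subst (λ l → left ∈ gen N lo l d′) length-left left∈) right∈
    join≡ : join (suc (lo + n)) a ((e , left) , γs) ≡ node
    join≡ rewrite take-length-++ αs (nonempties B) | drop-length-++ αs (nonempties B) | fill-flags βs = refl
    wt≡ : wt (suc r) lo (suc n) node ≡ d′ ⊕ e ⊕ d₂
    wt≡ = node-wt αs βs γs size goodˡ goodʳ
    length-node : length node ≡ suc (a + length γs)
    length-node = trans (length-++ αs) (+-suc a (length γs))
    finish : Complete (suc N) lo (suc n) node
    finish = subst₂ (λ k w → suc n ≡ k + vsum w × node ∈ gen (suc N) lo k w) (sym length-node) (sym wt≡)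
      (cong suc (proj₁ joined) ,
       subst (_∈ gen (suc N) lo (suc (a + length γs)) (d′ ⊕ e ⊕ d₂)) join≡ (proj₂ joined))

-- The enumeration agrees with gCoeff

∧⁻ : ∀ {x y} → T (x ∧ y) → T x × T y
∧⁻ = Equivalence.to T-∧

∧⁺ : ∀ {x y} → T x → T y → T (x ∧ y)
∧⁺ tx ty = Equivalence.from T-∧ (tx , ty)

not⁻ : ∀ {x} → T (not x) → ¬ T x
not⁻ {false} _ ()

not⁺ : ∀ {x} → ¬ T x → T (not x)
not⁺ {true}  ¬t = ⊥-elim (¬t tt)
not⁺ {false} _  = tt

does⁻ : ∀ {P : Set} (P? : Dec P) → T (does P?) → P
does⁻ (yes p) _ = p

does⁺ : ∀ {P : Set} (P? : Dec P) → P → T (does P?)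
does⁺ (yes _) _ = tt
does⁺ (no ¬p) p = ⊥-elim (¬p p)

module _ {A : Set} {p : A → Bool} where

  ∈-filterB⁻ : ∀ {x} xs → x ∈ filterB p xs → x ∈ xs × T (p x)
  ∈-filterB⁻ (y ∷ xs) x∈ with p y in eq
  ∈-filterB⁻ (y ∷ xs) (here refl) | true = here refl , Equivalence.from T-≡ eq
  ∈-filterB⁻ (y ∷ xs) (there x∈)  | true = let x∈′ , px = ∈-filterB⁻ xs x∈ in there x∈′ , px
  ∈-filterB⁻ (y ∷ xs) x∈ | false = let x∈′ , px = ∈-filterB⁻ xs x∈ in there x∈′ , px

  ∈-filterB⁺ : ∀ {x xs} → x ∈ xs → T (p x) → x ∈ filterB p xs
  ∈-filterB⁺ {x} (here refl) px rewrite Equivalence.to T-≡ px = here refl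
  ∈-filterB⁺ {xs = y ∷ xs} (there x∈) px with p y
  ... | true  = there (∈-filterB⁺ x∈ px)
  ... | false = ∈-filterB⁺ x∈ px

  filterB-unique : ∀ {xs} → Unique xs → Unique (filterB p xs)
  filterB-unique []        = []
  filterB-unique {x ∷ xs} (x∉ ∷ u) with p x
  ... | true  = All.tabulate (λ y∈ → All.lookup x∉ (proj₁ (∈-filterB⁻ xs y∈))) ∷ filterB-unique u
  ... | false = filterB-unique u

  allB⁻ : ∀ {x} xs → T (allB p xs) → x ∈ xs → T (p x)
  allB⁻ (y ∷ xs) h (here refl) = proj₁ (∧⁻ h)
  allB⁻ (y ∷ xs) h (there x∈)  = allB⁻ xs (proj₂ (∧⁻ {p y} h)) x∈

  allB⁺ : ∀ xs → (∀ {x} → x ∈ xs → T (p x)) → T (allB p xs)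
  allB⁺ []       h = tt
  allB⁺ (x ∷ xs) h = ∧⁺ (h (here refl)) (allB⁺ xs (h ∘ there))

elem⁻ : ∀ {a} w → T (elem a w) → a ∈ w
elem⁻ {a} (b ∷ w) h with Equivalence.to (T-∨ {a ≡ᵇ b}) h
... | inj₁ eq = here (≡ᵇ⇒≡ a b eq)
... | inj₂ h′ = there (elem⁻ w h′)

elem⁺ : ∀ {a} w → a ∈ w → T (elem a w)
elem⁺ {a} (b ∷ w) (here refl) = Equivalence.from (T-∨ {a ≡ᵇ b}) (inj₁ (≡⇒≡ᵇ a b refl))
elem⁺ {a} (b ∷ w) (there a∈)  = Equivalence.from (T-∨ {a ≡ᵇ b}) (inj₂ (elem⁺ w a∈))

anyElem⁻ : ∀ {a} t → T (anyB (elem a) t) → a ∈ concat t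
anyElem⁻ {a} (α ∷ t) h with Equivalence.to (T-∨ {elem a α}) h
... | inj₁ a∈α = ∈-++⁺ˡ (elem⁻ α a∈α)
... | inj₂ a∈t = ∈-++⁺ʳ α (anyElem⁻ t a∈t)

anyElem⁺ : ∀ {a} t → a ∈ concat t → T (anyB (elem a) t)
anyElem⁺ {a} (α ∷ t) a∈ with ∈-++⁻ α a∈
... | inj₁ a∈α = Equivalence.from (T-∨ {elem a α}) (inj₁ (elem⁺ α a∈α))
... | inj₂ a∈t = Equivalence.from (T-∨ {elem a α}) (inj₂ (anyElem⁺ t a∈t))

disjointComponents⁻ : ∀ t → T (disjointComponents t) → Separated t
disjointComponents⁻ []      h = tt
disjointComponents⁻ (α ∷ t) h =
  (λ y∈α y∈t → not⁻ (allB⁻ α (proj₁ (∧⁻ h)) y∈α) (anyElem⁺ t y∈t)) ,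
  disjointComponents⁻ t (proj₂ (∧⁻ {allB _ α} h))

disjointComponents⁺ : ∀ t → Separated t → T (disjointComponents t)
disjointComponents⁺ []      _           = tt
disjointComponents⁺ (α ∷ t) (dis , sep) =
  ∧⁺ (allB⁺ α (λ y∈α → not⁺ (dis y∈α ∘ anyElem⁻ t))) (disjointComponents⁺ t sep)

patFrom⁻ : ∀ {a} w → T (patFrom a w) → PatFrom a w
patFrom⁻ []      h = tt
patFrom⁻ {a} (b ∷ w) h =
  (λ a∈w → [ (λ ne → ⊥-elim (not⁻ ne (elem⁺ w a∈w))) , ≤ᵇ⇒≤ b a ]′
             (Equivalence.to (T-∨ {not (elem a w)}) (proj₁ (∧⁻ h)))) ,
  patFrom⁻ w (proj₂ (∧⁻ {not (elem a w) ∨ (b ≤ᵇ a)} h))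

patFrom⁺ : ∀ {a} w → PatFrom a w → T (patFrom a w)
patFrom⁺ []      _       = tt
patFrom⁺ {a} (b ∷ w) (h , p) = ∧⁺ first (patFrom⁺ w p)
  where
  first : T (not (elem a w) ∨ (b ≤ᵇ a))
  first with elem a w in eq
  ... | false = tt
  ... | true  = ≤⇒≤ᵇ (h (elem⁻ w (Equivalence.from T-≡ eq)))

patternOK⁻ : ∀ w → T (patternOK w) → Pat w
patternOK⁻ []      h = tt
patternOK⁻ (a ∷ w) h = patFrom⁻ w (proj₁ (∧⁻ h)) , patternOK⁻ w (proj₂ (∧⁻ {patFrom a w} h))

patternOK⁺ : ∀ w → Pat w → T (patternOK w)
patternOK⁺ []      _       = tt
patternOK⁺ (a ∷ w) (h , p) = ∧⁺ (patFrom⁺ w h) (patternOK⁺ w p)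

idWord-unique : ∀ n → Unique (idWord n)
idWord-unique n = Unique.applyUpTo⁺₁ suc n (λ i<j _ eq → <⇒≢ i<j (suc-injective eq))

wordsOf-unique : ∀ n ℓ → Unique (wordsOf n ℓ)
wordsOf-unique n zero    = [] ∷ []
wordsOf-unique n (suc ℓ) = concatMap-unique (idWord-unique n)
  (λ _ → map-unique (wordsOf-unique n ℓ) (λ _ _ eq → proj₂ (∷-injective eq)))
  (λ {a} {b} _ _ w∈ w∈′ → same (∈-map⁻ (a ∷_) w∈) (∈-map⁻ (b ∷_) w∈′))
  where
  same : ∀ {a b : ℕ} {w} → (∃ λ u → u ∈ wordsOf n ℓ × w ≡ a ∷ u) → (∃ λ u → u ∈ wordsOf n ℓ × w ≡ b ∷ u) → a ≡ b
  same (_ , _ , refl) (_ , _ , refl) = refl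

∈-wordsOf⁺ : ∀ n w → (∀ {y} → y ∈ w → y ∈ idWord n) → w ∈ wordsOf n (length w)
∈-wordsOf⁺ n []      h = here refl
∈-wordsOf⁺ n (a ∷ w) h = ∈-concatMap-intro (h (here refl)) (∈-map⁺ (a ∷_) (∈-wordsOf⁺ n w (h ∘ there)))

take-suc-nonempty : ∀ i (w : Word) → i < length w → take (suc i) w ≢ []
take-suc-nonempty i (b ∷ w) _ ()

∈-splits⁻ : ∀ k w {t} → t ∈ splits k w → concat t ≡ w × length t ≡ k × All (_≢ []) t
∈-splits⁻ zero    []      (here refl) = refl , refl , []
∈-splits⁻ (suc k) w t∈ with ∈-concatMap-elim (upTo (length w)) t∈
... | i , i∈ , t∈i with ∈-map⁻ (take (suc i) w ∷_) t∈i
... | s , s∈ , refl with ∈-splits⁻ k (drop (suc i) w) s∈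
... | eq , len , ne = trans (cong (take (suc i) w ++_) eq) (take++drop≡id (suc i) w) , cong suc len ,
                      take-suc-nonempty i w (∈-upTo⁻ i∈) ∷ ne

∈-splits⁺ : ∀ t → All (_≢ []) t → t ∈ splits (length t) (concat t)
∈-splits⁺ []            _        = here refl
∈-splits⁺ ([] ∷ t)      (n ∷ ne) = ⊥-elim (n refl)
∈-splits⁺ ((b ∷ α) ∷ t) (n ∷ ne) =
  ∈-concatMap-intro {x = length α} (∈-upTo⁺ (s≤s (subst (length α ≤_) (sym (length-++ α)) (m≤m+n _ _))))
    (subst₂ (λ u v → (b ∷ α) ∷ t ∈ map ((b ∷ u) ∷_) (splits (length t) v))
            (sym (take-length-++ α (concat t))) (sym (drop-length-++ α (concat t)))
            (∈-map⁺ ((b ∷ α) ∷_) (∈-splits⁺ t ne)))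

take-injective : ∀ {A : Set} {i j} (w : List A) → i < length w → j < length w →
                 take (suc i) w ≡ take (suc j) w → i ≡ j
take-injective {i = zero}  {zero}  w       _ _ eq = refl
take-injective {i = zero}  {suc j} (a ∷ b ∷ w) _ _ ()
take-injective {i = suc i} {zero}  (a ∷ b ∷ w) _ _ ()
take-injective {i = zero}  {suc j} (a ∷ []) _ (s≤s ()) _
take-injective {i = suc i} {zero}  (a ∷ []) (s≤s ()) _ _
take-injective {i = suc i} {suc j} (a ∷ w) (s≤s i<) (s≤s j<) eq =
  cong suc (take-injective w i< j< (proj₂ (∷-injective eq)))

splits-unique : ∀ k w → Unique (splits k w)
splits-unique zero    []      = [] ∷ []
splits-unique zero    (_ ∷ _) = []
splits-unique (suc k) w = concatMap-unique (Unique.upTo⁺ (length w))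
  (λ {i} _ → map-unique (splits-unique k (drop (suc i) w)) (λ _ _ eq → proj₂ (∷-injective eq)))
  (λ {i} {j} i∈ j∈ t∈ t∈′ → same i∈ j∈ (∈-map⁻ (take (suc i) w ∷_) t∈) (∈-map⁻ (take (suc j) w ∷_) t∈′))
  where
  same : ∀ {i j t} → i ∈ upTo (length w) → j ∈ upTo (length w) →
         (∃ λ s → s ∈ splits k (drop (suc i) w) × t ≡ take (suc i) w ∷ s) →
         (∃ λ s → s ∈ splits k (drop (suc j) w) × t ≡ take (suc j) w ∷ s) → i ≡ j
  same i∈ j∈ (_ , _ , refl) (_ , _ , eq) =
    take-injective w (∈-upTo⁻ i∈) (∈-upTo⁻ j∈) (proj₁ (∷-injective eq))

sumℕ-map-+ : ∀ {A : Set} (f g : A → ℕ) xs → sumℕ (map (λ x → f x + g x) xs) ≡ sumℕ (map f xs) + sumℕ (map g xs)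
sumℕ-map-+ f g []       = refl
sumℕ-map-+ f g (x ∷ xs) = trans (cong (f x + g x +_) (sumℕ-map-+ f g xs)) (+-interchange (f x) (g x) _ _)

sumℕ-const : ∀ {A : Set} {f : A → ℕ} {c} xs → (∀ {x} → x ∈ xs → f x ≡ c) → sumℕ (map f xs) ≡ length xs * c
sumℕ-const []       h = refl
sumℕ-const (x ∷ xs) h = cong₂ _+_ (h (here refl)) (sumℕ-const xs (h ∘ there))

sumℕ-indicator : ∀ {b} xs → Unique xs → b ∈ xs → sumℕ (map (λ a → if a ≡ᵇ b then 1 else 0) xs) ≡ 1
sumℕ-indicator {b} (x ∷ xs) (x∉ ∷ u) (here refl) rewrite ≡ᵇ-refl x =
  cong suc (trans (sumℕ-const {c = 0} xs (λ {a} a∈ → cong (λ c → if c then 1 else 0)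
                    (≢⇒≡ᵇ-false {a} {x} (≢-sym (All.lookup x∉ a∈))))) (*-zeroʳ (length xs)))
sumℕ-indicator {b} (x ∷ xs) (x∉ ∷ u) (there b∈) rewrite ≢⇒≡ᵇ-false {x} {b} (All.lookup x∉ b∈) =
  sumℕ-indicator xs u b∈

-- Double counting of positions. It yields the length of `concat t`, which is needed because
-- `rPerms` filters words of one prescribed length.
sumℕ-count : ∀ {xs} w → Unique xs → (∀ {y} → y ∈ w → y ∈ xs) → sumℕ (map (λ a → count a w) xs) ≡ length w
sumℕ-count {xs} []      u h = trans (sumℕ-const {c = 0} xs (λ _ → refl)) (*-zeroʳ (length xs))
sumℕ-count {xs} (b ∷ w) u h =
  trans (sumℕ-map-+ (λ a → if a ≡ᵇ b then 1 else 0) (λ a → count a w) xs)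
        (cong₂ _+_ (sumℕ-indicator xs u (h (here refl))) (sumℕ-count w u (h ∘ there)))

unique-length-≤ : ∀ {A : Set} {xs : List A} ys → Unique xs → (∀ {x} → x ∈ xs → x ∈ ys) → length xs ≤ length ys
unique-length-≤ ys []  sub = z≤n
unique-length-≤ {xs = x ∷ xs} ys (x∉ ∷ u) sub with ∈-∃++ (sub (here refl))
... | us , vs , refl = subst (suc (length xs) ≤_) (sym (trans (length-++ us) (+-suc _ _)))
    (s≤s (subst (length xs ≤_) (length-++ us) (unique-length-≤ (us ++ vs) u sub′)))
  where
  sub′ : ∀ {y} → y ∈ xs → y ∈ us ++ vs
  sub′ y∈ with ∈-++⁻ us (sub (there y∈))
  ... | inj₁ y∈us         = ∈-++⁺ˡ y∈us
  ... | inj₂ (here refl)  = ⊥-elim (All.lookup x∉ y∈ refl)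
  ... | inj₂ (there y∈vs) = ∈-++⁺ʳ us y∈vs

module Counting {r : ℕ} where
  -- Repeats the list inside `gCoeff`, so that its length is `gCoeff` by computation.
  sorting : ∀ n k → Mon (suc r) → List (List Word)
  sorting n k m = filterB (λ t → twoStackSortable n t ∧ does (Vec.≡-dec _≟_ (weight (suc r) n t) m))
                          (tuples (suc r) n k)

  sorting-unique : ∀ n k m → Unique (sorting n k m)
  sorting-unique n k m = filterB-unique (filterB-unique (concatMap-unique
    (filterB-unique (wordsOf-unique n (suc r * n))) (λ {w} _ → splits-unique k w)
    λ {w} {w′} _ _ t∈ t∈′ → trans (sym (proj₁ (∈-splits⁻ k w t∈))) (proj₁ (∈-splits⁻ k w′ t∈′))))

  ∈-sorting⁻ : ∀ n k m {t} → t ∈ sorting n k m →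
               Good (suc r) 0 n t × length t ≡ k × wt (suc r) 0 n t ≡ m
  ∈-sorting⁻ n k m {t} t∈ =
    let t∈tuples , ok  = ∈-filterB⁻ (tuples (suc r) n k) t∈
        sorted , wt≡   = ∧⁻ {twoStackSortable n t} ok
        t∈splits , dis = ∈-filterB⁻ (concatMap (splits k) (rPerms (suc r) n)) t∈tuples
        w , w∈ , t∈w   = ∈-concatMap-elim (rPerms (suc r) n) t∈splits
        concat≡ , len , ne = ∈-splits⁻ k w t∈w
        _ , perm       = ∈-filterB⁻ (wordsOf n (suc r * n)) w∈
        inside , perm′ = ∧⁻ {allB _ w} perm
        counts , pat   = ∧⁻ {allB _ (idWord n)} perm′
    in record
         { nonempty = ne
         ; pat      = pat-concat⁻ t (subst Pat (sym concat≡) (patternOK⁻ w pat))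
         ; sep      = disjointComponents⁻ t dis
         ; cnt      = λ {y} y∈ → subst (λ w → count y w ≡ suc r) (sym concat≡)
                        (≡ᵇ⇒≡ (count y w) (suc r)
                          (allB⁻ (idWord n) counts (elem⁻ (idWord n) (allB⁻ w inside (subst (y ∈_) concat≡ y∈)))))
         ; sorted   = trans (does⁻ (≡-dec _≟_ (S (concat (map S t))) (idWord n)) sorted) (sym (interval≡idWord n))
         } , len , trans (sym (weight≡wt (suc r) n t)) (does⁻ (Vec.≡-dec _≟_ (weight (suc r) n t) m) wt≡)

  ∈-sorting⁺ : ∀ n {t} → Good (suc r) 0 n t → t ∈ sorting n (length t) (wt (suc r) 0 n t)
  ∈-sorting⁺ n {t} g =
    ∈-filterB⁺ (∈-filterB⁺ (∈-concatMap-intro {x = concat t}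
        (∈-filterB⁺ (subst (λ ℓ → concat t ∈ wordsOf n ℓ) length≡ (∈-wordsOf⁺ n (concat t) inside))
          (∧⁺ (allB⁺ (concat t) (elem⁺ (idWord n) ∘ inside))
            (∧⁺ (allB⁺ (idWord n) (λ {a} a∈ → ≡⇒≡ᵇ (count a (concat t)) (suc r) (counts a∈)))
                (patternOK⁺ (concat t) (pat-concat⁺ t sep pat)))))
        (∈-splits⁺ t nonempty))
      (disjointComponents⁺ t sep))
      (∧⁺ (does⁺ (≡-dec _≟_ (S (concat (map S t))) (idWord n)) (trans sorted (interval≡idWord n)))
          (does⁺ (Vec.≡-dec _≟_ (weight (suc r) n t) (wt (suc r) 0 n t)) (weight≡wt (suc r) n t)))
    where
    open Good g
    inside : ∀ {y} → y ∈ concat t → y ∈ idWord n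
    inside y∈ = let 0<y , y≤n = letters⁻ t sorted y∈ in
      subst (_ ∈_) (interval≡idWord n) (∈-interval⁺ 0 n 0<y y≤n)
    counts : ∀ {a} → a ∈ idWord n → count a (concat t) ≡ suc r
    counts a∈ = let 0<a , a≤n = ∈-interval⁻ 0 n (subst (_ ∈_) (sym (interval≡idWord n)) a∈) in
      cnt (letters⁺ t sorted 0<a a≤n)
    length≡ : length (concat t) ≡ suc r * n
    length≡ = trans (sym (sumℕ-count (concat t) (idWord-unique n) inside))
      (trans (sumℕ-const (idWord n) counts)
      (trans (cong (_* suc r) (trans (cong length (sym (interval≡idWord n))) (length-interval 0 n)))
             (*-comm n (suc r))))

  -- Two lists without repetitions and with the same members have equal length; each inclusion gives
  -- one inequality.
  gCoeff-gen : ∀ {N} k m → k + vsum m ≤ N → gCoeff (suc r) (k + vsum m) k m ≡ length (gen N 0 k m)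
  gCoeff-gen {N} k m n≤N = ≤-antisym
    (unique-length-≤ (gen N 0 k m) (sorting-unique n k m) sound′)
    (unique-length-≤ (sorting n k m) (gen-unique N 0 k m) complete′)
    where
    n : ℕ
    n = k + vsum m
    sound′ : ∀ {t} → t ∈ sorting n k m → t ∈ gen N 0 k m
    sound′ {t} t∈ = let g , len , wt≡ = ∈-sorting⁻ n k m t∈ in
      subst₂ (λ k m → t ∈ gen N 0 k m) len wt≡ (proj₂ (gen-complete N 0 n t n≤N g))
    complete′ : ∀ {t} → t ∈ gen N 0 k m → t ∈ sorting n k m
    complete′ {t} t∈ = let sound g len wt≡ = gen-sound N 0 k m t∈ in
      subst₂ (λ k m → t ∈ sorting n k m) len wt≡ (∈-sorting⁺ n g)

  -- A counted tuple would satisfy letters = components + descents. Hence a monomial of g_k receives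
  -- a contribution from a single n, which settles convergence of the sum over n.
  gCoeff-vanishes : ∀ n k m → n ≢ k + vsum m → gCoeff (suc r) n k m ≡ 0
  gCoeff-vanishes n k m n≢ = n≤0⇒n≡0 (unique-length-≤ [] (sorting-unique n k m)
    λ {t} t∈ → let g , len , wt≡ = ∈-sorting⁻ n k m t∈ in
      ⊥-elim (n≢ (subst₂ (λ k m → n ≡ k + vsum m) len wt≡ (proj₁ (gen-complete n 0 n t ≤-refl g)))))

-- The functional equation

-- Normalised fractions involve a gcd that does not compute on variables. The detour through
-- unnormalised fractions with denominator 1 reduces the claim to integers.
fromℕ-+ : ∀ a b → fromℕ (a + b) ≡ fromℕ a ℚ.+ fromℕ b
fromℕ-+ a b = ℚ.toℚᵘ-injective (begin
  ℚ.toℚᵘ (fromℕ (a + b))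
    ≈⟨ ℚ.toℚᵘ-fromℚᵘ (mkℚᵘ (ℤ.+ (a + b)) 0) ⟩
  mkℚᵘ (ℤ.+ (a + b)) 0
    ≈⟨ *≡* (cong (ℤ._* ℤ.+ 1) (cong₂ ℤ._+_ (sym (ℤ.*-identityʳ (ℤ.+ a))) (sym (ℤ.*-identityʳ (ℤ.+ b))))) ⟩
  mkℚᵘ (ℤ.+ a) 0 ℚᵘ.+ mkℚᵘ (ℤ.+ b) 0
    ≈⟨ ℚᵘ.+-cong
         (ℚᵘ.≃-sym (ℚ.toℚᵘ-fromℚᵘ (mkℚᵘ (ℤ.+ a) 0)))
         (ℚᵘ.≃-sym (ℚ.toℚᵘ-fromℚᵘ (mkℚᵘ (ℤ.+ b) 0))) ⟩
  ℚ.toℚᵘ (fromℕ a) ℚᵘ.+ ℚ.toℚᵘ (fromℕ b)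
    ≈⟨ ℚᵘ.≃-sym (ℚ.toℚᵘ-homo-+ (fromℕ a) (fromℕ b)) ⟩
  ℚ.toℚᵘ (fromℕ a ℚ.+ fromℕ b) ∎)
  where open ℚᵘ.≃-Reasoning

fromℕ-* : ∀ a b → fromℕ (a * b) ≡ fromℕ a ℚ.* fromℕ b
fromℕ-* a b = ℚ.toℚᵘ-injective (begin
  ℚ.toℚᵘ (fromℕ (a * b))
    ≈⟨ ℚ.toℚᵘ-fromℚᵘ (mkℚᵘ (ℤ.+ (a * b)) 0) ⟩
  mkℚᵘ (ℤ.+ (a * b)) 0
    ≈⟨ *≡* (cong (ℤ._* ℤ.+ 1) (ℤ.pos-* a b)) ⟩
  mkℚᵘ (ℤ.+ a) 0 ℚᵘ.* mkℚᵘ (ℤ.+ b) 0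
    ≈⟨ ℚᵘ.*-cong
         (ℚᵘ.≃-sym (ℚ.toℚᵘ-fromℚᵘ (mkℚᵘ (ℤ.+ a) 0)))
         (ℚᵘ.≃-sym (ℚ.toℚᵘ-fromℚᵘ (mkℚᵘ (ℤ.+ b) 0))) ⟩
  ℚ.toℚᵘ (fromℕ a) ℚᵘ.* ℚ.toℚᵘ (fromℕ b)
    ≈⟨ ℚᵘ.≃-sym (ℚ.toℚᵘ-homo-* (fromℕ a) (fromℕ b)) ⟩
  ℚ.toℚᵘ (fromℕ a ℚ.* fromℕ b) ∎)
  where open ℚᵘ.≃-Reasoning

module _ {A : Set} where

  fromℕ-sum : ∀ (f : A → ℕ) (g : A → ℚ) xs → (∀ x → fromℕ (f x) ≡ g x) →
              fromℕ (sumℕ (map f xs)) ≡ sumℚ (map g xs)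
  fromℕ-sum f g []       eq = refl
  fromℕ-sum f g (x ∷ xs) eq = trans (fromℕ-+ (f x) (sumℕ (map f xs))) (cong₂ ℚ._+_ (eq x) (fromℕ-sum f g xs eq))

  sumℚ-cong : ∀ {f g : A → ℚ} xs → (∀ {x} → x ∈ xs → f x ≡ g x) → sumℚ (map f xs) ≡ sumℚ (map g xs)
  sumℚ-cong []       eq = refl
  sumℚ-cong (x ∷ xs) eq = cong₂ ℚ._+_ (eq (here refl)) (sumℚ-cong xs (eq ∘ there))

  sumₛ-at : ∀ {r} (F : A → Series r) xs m → sumₛ (map F xs) m ≡ sumℚ (map (λ x → F x m) xs)
  sumₛ-at F []       m = refl
  sumₛ-at F (x ∷ xs) m = cong (F x m ℚ.+_) (sumₛ-at F xs m)

  length-concatMap : ∀ {B : Set} (f : A → List B) (g : A → ℕ) xs → (∀ x → length (f x) ≡ g x) →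
                     length (concatMap f xs) ≡ sumℕ (map g xs)
  length-concatMap f g []       eq = refl
  length-concatMap f g (x ∷ xs) eq = trans (length-++ (f x)) (cong₂ _+_ (eq x) (length-concatMap f g xs eq))

length-cartesianProduct : ∀ {A B : Set} (xs : List A) (ys : List B) →
                          length (cartesianProduct xs ys) ≡ length xs * length ys
length-cartesianProduct []       ys = refl
length-cartesianProduct (x ∷ xs) ys = trans (length-++ (map (x ,_) ys))
  (cong₂ _+_ (length-map (x ,_) ys) (length-cartesianProduct xs ys))

-- The equation as a recursion on coefficients, and uniqueness.

module _ {r : ℕ} (h : ZSeries r) where

  Fsum : ℕ → Mon r → ℚ
  Fsum a d = sumℚ (map (λ j → sumℚ (map (λ d′ → h (a + j) d′ ℚ.* elemSym j (d ⊖ d′)) (below d)))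
                       (upTo (suc (suc r))))

  -- The coefficient of z^(k+1) x^m in zFG, unfolded into nested sums of rationals that can be
  -- matched index by index with the lengths of the lists in `gen`.
  step : ℕ → Mon r → ℚ
  step k m = sumℚ (map (λ a → sumℚ (map (λ d → Fsum a d ℚ.* h (k ∸ a) (m ⊖ d)) (below m))) (upTo (suc k)))

  Fof≡Fsum : ∀ a d → Fof h a d ≡ Fsum a d
  Fof≡Fsum a d = sumₛ-at (λ j → h (a + j) *ₛ elemSym j) (upTo (suc (suc r))) d

  rhs≡step : ∀ k m → (oneZ +z zTimes (Fof h *z h)) (suc k) m ≡ step k m
  rhs≡step k m = trans (ℚ.+-identityˡ _)
    (trans (sumₛ-at (λ a → Fof h a *ₛ h (k ∸ a)) (upTo (suc k)) m)
           (sumℚ-cong (upTo (suc k)) λ {a} _ → sumℚ-cong (below m) λ {d} _ →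
              cong (ℚ._* h (k ∸ a) (m ⊖ d)) (Fof≡Fsum a d)))

below-vsum : ∀ {s} (m : Vec ℕ s) {d} → d ∈ below m → vsum d + vsum (m ⊖ d) ≡ vsum m
below-vsum m {d} d∈ = trans (sym (vsum-⊕ d (m ⊖ d))) (cong vsum (below-⊕⊖ m d∈))

-- Every coefficient of h entering the recursion has a value of k + |m| smaller than (k + 1) + |m|.
step-cong : ∀ {r} {h h′ : ZSeries r} k m →
            (∀ k′ m′ → k′ + vsum m′ ≤ k + vsum m → h k′ m′ ≡ h′ k′ m′) → step h k m ≡ step h′ k m
step-cong {r} {h} {h′} k m eq = sumℚ-cong (upTo (suc k)) λ {a} a∈ → sumℚ-cong (below m) λ {d} d∈ →
  let a≤k : a ≤ k
      a≤k = s≤s⁻¹ (∈-upTo⁻ a∈)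
      d≤m : vsum d ≤ vsum m
      d≤m = subst (vsum d ≤_) (below-vsum m d∈) (m≤m+n _ _)
      d′≤m : vsum (m ⊖ d) ≤ vsum m
      d′≤m = subst (vsum (m ⊖ d) ≤_) (below-vsum m d∈) (m≤n+m _ _)
  in cong₂ ℚ._*_
       (sumℚ-cong (upTo (suc (suc r))) λ {j} _ → sumℚ-cong (below d) λ {d′} d′∈ →
          term a j d d′ d′∈ (+-mono-≤ a≤k d≤m))
       (eq (k ∸ a) (m ⊖ d) (+-mono-≤ (m∸n≤m k a) d′≤m))
  where
  term : ∀ a j d d′ → d′ ∈ below d → a + vsum d ≤ k + vsum m →
         h (a + j) d′ ℚ.* elemSym j (d ⊖ d′) ≡ h′ (a + j) d′ ℚ.* elemSym j (d ⊖ d′)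
  -- The index a + j may exceed k. But e_j vanishes here unless |d ⊖ d′| = j, and then a + j + |d′|
  -- = a + |d|, which is within the bound.
  term a j d d′ d′∈ bound with isElem j (d ⊖ d′) in el
  ... | false = trans (ℚ.*-zeroʳ (h (a + j) d′)) (sym (ℚ.*-zeroʳ (h′ (a + j) d′)))
  ... | true  = cong (ℚ._* 1ℚ) (eq (a + j) d′ (subst (_≤ k + vsum m) size bound))
    where
    size : a + vsum d ≡ a + j + vsum d′
    size = trans (cong (λ n → a + n) (trans (sym (below-vsum d d′∈))
      (trans (+-comm (vsum d′) _) (cong (_+ vsum d′) (proj₂ (isElem⁻ j (d ⊖ d′) (Equivalence.from T-≡ el)))))))
      (sym (+-assoc a j _))

solution-unique : ∀ {r} {h h′ : ZSeries r} → SatisfiesEq r h → SatisfiesEq r h′ → ∀ k m → h k m ≡ h′ k m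
solution-unique {r} {h} {h′} sol sol′ k m = go (k + vsum m) k m ≤-refl
  where
  go : ∀ N k m → k + vsum m ≤ N → h k m ≡ h′ k m
  go N       zero    m _         = trans (sol 0 m) (sym (sol′ 0 m))
  go (suc N) (suc k) m (s≤s k≤N) = trans (trans (sol (suc k) m) (rhs≡step h k m))
    (trans (step-cong k m (λ k′ m′ le → go N k′ m′ (≤-trans le k≤N)))
           (sym (trans (sol′ (suc k) m) (rhs≡step h′ k m))))

-- Counting the enumeration and solving the equation.

module _ {r : ℕ} where

  joinCount : ℕ → ℕ → Mon (suc r) → ℕ → Mon (suc r) → ℕ
  joinCount N k m a d = length (lefts {r} N 0 a d) * length (gen {r} N 0 (k ∸ a) (m ⊖ d))

  leftCount : ℕ → ℕ → Mon (suc r) → ℕ → Mon (suc r) → ℕ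
  leftCount N a d j d′ = if isElem j (d ⊖ d′) then length (gen {r} N 0 (a + j) d′) else 0

  mutual
    -- The offset enters only the letters that are written, never a range or a test. This replaces
    -- relabelling: a right tuple on shifted letters is counted by the same coefficient.
    length-gen-lo : ∀ N lo k m → length (gen {r} N lo k m) ≡ length (gen {r} N 0 k m)
    length-gen-lo N       lo zero    m = refl
    length-gen-lo zero    lo (suc k) m = refl
    length-gen-lo (suc N) lo (suc k) m = trans (length-gen-suc N lo k m) (sym (length-gen-suc N 0 k m))

    length-gen-suc : ∀ N lo k m → length (gen {r} (suc N) lo (suc k) m) ≡
                     sumℕ (map (λ a → sumℕ (map (joinCount N k m a) (below m))) (upTo (suc k)))
    length-gen-suc N lo k m =
      length-concatMap (λ a → concatMap (joins N lo k m a) (below m))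
        (λ a → sumℕ (map (joinCount N k m a) (below m))) (upTo (suc k)) λ a →
          length-concatMap (joins N lo k m a) (joinCount N k m a) (below m) λ d →
            trans (length-map (join (suc (lo + (k + vsum m))) a) (pairs N lo a d (k ∸ a) (m ⊖ d)))
            (trans (length-cartesianProduct (lefts N lo a d) (gen N (lo + (a + vsum d)) (k ∸ a) (m ⊖ d)))
            (cong₂ _*_ (trans (length-lefts N lo a d) (sym (length-lefts N 0 a d)))
                       (length-gen-lo N (lo + (a + vsum d)) (k ∸ a) (m ⊖ d))))

    length-lefts : ∀ N lo a d → length (lefts {r} N lo a d) ≡
                   sumℕ (map (λ j → sumℕ (map (leftCount N a d j) (below d))) (upTo (suc (suc (suc r)))))
    length-lefts N lo a d =
      length-concatMap (λ j → concatMap (leftsFrom N lo a d j) (below d))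
        (λ j → sumℕ (map (leftCount N a d j) (below d))) (upTo (suc (suc (suc r)))) λ j →
          length-concatMap (leftsFrom N lo a d j) (leftCount N a d j) (below d) (length-leftsFrom j)
      where
      length-leftsFrom : ∀ j d′ → length (leftsFrom {r} N lo a d j d′) ≡ leftCount N a d j d′
      length-leftsFrom j d′ with isElem j (d ⊖ d′)
      ... | true  = trans (length-map (d ⊖ d′ ,_) (gen N lo (a + j) d′)) (length-gen-lo N lo (a + j) d′)
      ... | false = refl

  number : ℕ → ZSeries (suc r)
  number N k m = fromℕ (length (gen {r} N 0 k m))

  number-lefts : ∀ N a d → fromℕ (length (lefts {r} N 0 a d)) ≡ Fsum (number N) a d
  number-lefts N a d = trans (cong fromℕ (length-lefts N 0 a d))
    (fromℕ-sum (λ j → sumℕ (map (leftCount N a d j) (below d))) (λ j → sumℚ (map (term j) (below d)))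
               (upTo (suc (suc (suc r)))) λ j → fromℕ-sum (leftCount N a d j) (term j) (below d) (term≡ j))
    where
    term : ℕ → Mon (suc r) → ℚ
    term j d′ = number N (a + j) d′ ℚ.* elemSym j (d ⊖ d′)
    term≡ : ∀ j d′ → fromℕ (leftCount N a d j d′) ≡ term j d′
    term≡ j d′ with isElem j (d ⊖ d′)
    ... | true  = sym (ℚ.*-identityʳ (number N (a + j) d′))
    ... | false = sym (ℚ.*-zeroʳ (number N (a + j) d′))

  number-step : ∀ N k m → number (suc N) (suc k) m ≡ step (number N) k m
  number-step N k m = trans (cong fromℕ (length-gen-suc N 0 k m))
    (fromℕ-sum (λ a → sumℕ (map (joinCount N k m a) (below m))) (λ a → sumℚ (map (term a) (below m)))
               (upTo (suc k)) λ a → fromℕ-sum (joinCount N k m a) (term a) (below m) λ d →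
      trans (fromℕ-* (length (lefts {r} N 0 a d)) (length (gen {r} N 0 (k ∸ a) (m ⊖ d))))
            (cong (ℚ._* number N (k ∸ a) (m ⊖ d)) (number-lefts N a d)))
    where
    term : ℕ → Mon (suc r) → ℚ
    term a d = Fsum (number N) a d ℚ.* number N (k ∸ a) (m ⊖ d)

  -- The one value of n that can contribute to this coefficient is inserted directly, so no limit is
  -- taken.
  gSeries : ZSeries (suc r)
  gSeries k m = fromℕ (gCoeff (suc r) (k + vsum m) k m)

  gSeries≡number : ∀ {N} k m → k + vsum m ≤ N → gSeries k m ≡ number N k m
  gSeries≡number k m le = cong fromℕ (Counting.gCoeff-gen k m le)

  gSeries-solution : SatisfiesEq (suc r) gSeries
  gSeries-solution zero m = trans (gSeries≡number 0 m ≤-refl) base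
    where
    base : number (vsum m) 0 m ≡ oneₛ m ℚ.+ 0ℚ
    base with isZero m
    ... | true  = refl
    ... | false = refl
  gSeries-solution (suc k) m = trans (gSeries≡number (suc k) m ≤-refl)
    (trans (number-step (k + vsum m) k m)
    -- The fuel k + |m| suffices for every coefficient that `step` reads, by the bound in
    -- `step-cong`, so the fuel can be removed from all of them at once.
    (trans (step-cong k m (λ k′ m′ le → sym (gSeries≡number k′ m′ le)))
           (sym (rhs≡step gSeries k m))))

  partialSum-small : ∀ k m N → N ≤ k + vsum m → partialSum (suc r) k m N ≡ 0
  partialSum-small k m zero    _  = refl
  partialSum-small k m (suc N) le = cong₂ _+_ (partialSum-small k m N (<⇒≤ le))
                                              (Counting.gCoeff-vanishes N k m (<⇒≢ le))

  partialSum-large : ∀ k m N → k + vsum m < N →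
                     partialSum (suc r) k m N ≡ gCoeff (suc r) (k + vsum m) k m
  partialSum-large k m (suc N) (s≤s le) with m≤n⇒m<n∨m≡n le
  ... | inj₁ lt   = trans (cong₂ _+_ (partialSum-large k m N lt)
                                     (Counting.gCoeff-vanishes N k m (≢-sym (<⇒≢ lt)))) (+-identityʳ _)
  ... | inj₂ refl = cong (_+ gCoeff (suc r) N k m) (partialSum-small k m N ≤-refl)

theorem2 : (r : ℕ) → 1 ≤ r →
    Σ (ZSeries r) (λ g →
    IsGFamily r g × SatisfiesEq r g ×
    ((h : ZSeries r) → SatisfiesEq r h → ∀ k (m : Mon r) → h k m ≡ g k m))
theorem2 (suc r) _ = gSeries ,
  -- `partialSum` at N adds the terms with n < N, so the contributing n = k + |m| is included only
  -- from its successor on.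
  (λ k m → suc (k + vsum m) , λ N le → cong fromℕ (sym (partialSum-large k m N le))) ,
  gSeries-solution ,
  λ h sol → solution-unique sol gSeries-solution
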